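{- For every integer $k \ge 1$ there is a constant $c_1 > 0$ (depending only on $k$) such that for every integer $n \ge 2$, $$\overrightarrow{r}(\overrightarrow{P_n}, k+1) \ \ge\ c_1\, n^{2k} (\log n)^{2/(k+1)}.$$
   Context: Graphs are finite. An oriented graph is a directed graph without loops such that for every two vertices $x, y$ at most one of $xy$ and $yx$ is an edge. $\overrightarrow{P_n}$ denotes the directed path on $n$ vertices, i.e. the oriented graph with vertices $v_1, \ldots, v_n$ and edges $v_i v_{i+1}$ for $1 \le i \le n-1$. For an oriented graph $H$ and an integer $q \ge 1$, the $q$-colour oriented size Ramsey number $\overrightarrow{r}(H, q)$ is the minimum $m$ for which there exists an oriented graph $G$ with $m$ edges such that every colouring of the edges of $G$ with $q$ colours contains a monochromatic copy of $H$ (as a not necessarily induced subgraph, with orientations preserved). All logarithms are in base $2$. -}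

module Defs where

open import Algebra.Definitions.RawSemiring using (_^_)
open import Data.Bool using (Bool; T)
open import Data.Fin using (Fin; toℕ)
open import Data.Integer using (+_)
open import Data.List using (length; filterᵇ; cartesianProduct; allFin)
open import Data.Nat using (ℕ; suc; NonZero; _≤_; _≡ᵇ_)
import Data.Nat as ℕ
open import Data.Nat.Properties using (≡ᵇ⇒≡; 1+n≢n; m+1+n≢n)
open import Data.Product using (Σ; ∃; _×_; _,_; uncurry)
open import Data.Rational using (ℚ; 0ℚ; _*_; _/_; +-*-rawSemiring)
import Data.Rational as ℚ
open import Function.Definitions using (Injective)
open import Level using (0ℓ)
open import Relation.Binary.Definitions using (Irreflexive; Asymmetric)
open import Relation.Binary.PropositionalEquality using (_≡_; refl; sym; trans; cong)
open import Relation.Unary using (Pred)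

record OrientedGraph : Set where
  field
    order : ℕ
    edge  : Fin order → Fin order → Bool

  infix 4 _⟶_
  _⟶_ : Fin order → Fin order → Set
  x ⟶ y = T (edge x y)

  field
    loopless : Irreflexive _≡_ _⟶_
    oriented : Asymmetric _⟶_

  size : ℕ
  size = length (filterᵇ (uncurry edge) (cartesianProduct (allFin order) (allFin order)))

open OrientedGraph using (order; size)

infix 4 _[_⟶_]
_[_⟶_] : (G : OrientedGraph) → Fin (order G) → Fin (order G) → Set
G [ x ⟶ y ] = OrientedGraph._⟶_ G x y

path : ℕ → OrientedGraph
path n = record
  { order    = n
  ; edge     = λ i j → toℕ j ≡ᵇ suc (toℕ i)
  ; loopless = λ { {x} refl e → 1+n≢n (sym (≡ᵇ⇒≡ (toℕ x) _ e)) }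
  ; oriented = λ {x} {y} e f →
      m+1+n≢n 1 (sym (trans (≡ᵇ⇒≡ (toℕ y) _ e) (cong suc (≡ᵇ⇒≡ (toℕ x) _ f))))
  }

-- Well defined on edges, since T b has at most one inhabitant.
Colouring : OrientedGraph → ℕ → Set
Colouring G q = ∀ x y → G [ x ⟶ y ] → Fin q

MonochromaticCopy : (H G : OrientedGraph) {q : ℕ} → Colouring G q → Set
MonochromaticCopy H G {q} χ =
  Σ (Fin q) λ c →
  Σ (Fin (order H) → Fin (order G)) λ f →
    Injective _≡_ _≡_ f ×
    (∀ x y → H [ x ⟶ y ] → Σ (G [ f x ⟶ f y ]) λ e → χ (f x) (f y) e ≡ c)

Arrows : (G H : OrientedGraph) → ℕ → Set
Arrows G H q = (χ : Colouring G q) → MonochromaticCopy H G χ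

-- The number m is the minimum defining the q-colour oriented size Ramsey
-- number of H.
IsOrientedSizeRamsey : OrientedGraph → ℕ → ℕ → Set
IsOrientedSizeRamsey H q m =
  (Σ OrientedGraph λ G → size G ≡ m × Arrows G H q) ×
  (∀ G → Arrows G H q → m ≤ size G)

fromℕ : ℕ → ℚ
fromℕ m = + m / 1

infixr 8 _^ℚ_
_^ℚ_ : ℚ → ℕ → ℚ
_^ℚ_ = _^_ +-*-rawSemiring

-- A nonnegative real number is represented by an inhabited bounded set of
-- nonnegative rationals whose supremum it is; different sets may represent
-- the same number.
ℝ≥0 : Set₁
ℝ≥0 = Pred ℚ 0ℓ

-- The base-2 logarithm of n ≥ 1:  p / q ≤ log n  if and only if  2 ^ p ≤ n ^ q.
log₂ : ℕ → ℝ≥0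
log₂ n s = ∃ λ p → ∃ λ d → s ≡ + p / suc d × 2 ℕ.^ p ≤ n ℕ.^ suc d

-- The real power L ^ (a / b):  the nonnegative t with  t ^ b ≤ s ^ a  for
-- some s in L have as supremum the b-th root of L ^ a.
infix 8 _^[_/_]
_^[_/_] : ℝ≥0 → (a b : ℕ) → .{{NonZero b}} → ℝ≥0
(L ^[ a / b ]) t = 0ℚ ℚ.≤ t × ∃ λ s → L s × t ^ℚ b ℚ.≤ s ^ℚ a

-- The product of a rational r ≥ 0 with a nonnegative real.
infix 7 _·_
_·_ : ℚ → ℝ≥0 → ℝ≥0
(r · L) x = ∃ λ t → L t × x ≡ r * t

infix 4 _≤ᵣ_
_≤ᵣ_ : ℝ≥0 → ℚ → Set
L ≤ᵣ y = ∀ x → L x → x ℚ.≤ y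

{-# OPTIONS --safe #-}
-- Suppose the vertices of G fall into M classes, each of them acyclic without a
-- path on more than ℓ vertices, where M ≤ m ^ k and ℓ ≤ h ^ (k + 1).  Write the
-- class of a vertex in base m as c₁ … c_k and its level within the class in
-- base h as l₀ … l_k.  Every edge raises one of the potentials cᵢ h + lᵢ (i ≥ 1)
-- and (k (m - 1) - Σ cᵢ) h + l₀; colouring it accordingly, no monochromatic path
-- has more than k m h vertices.
--
-- It remains to show that N² edges allow ℓ M = O(N) for some ℓ of order log N.
-- Removing N / ℓ maximal independent sets leaves at most ℓ N vertices.  As long
-- as r ≥ N vertices remain, extract an acyclic set I of height at most ℓ as
-- large as possible, up to the size ℓ (r / N)².  If it falls short, few of the
-- remaining vertices have few neighbours in I: otherwise many of them would have
-- the same few neighbours, and exchanging those for an acyclic set of size ℓ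
-- (Erdős–Moser) would enlarge I.  So removing I destroys at least ℓ N / 8 edges.
-- Each kind of extraction happens O(N / ℓ) times.  The last N vertices are
-- covered by acyclic sets of size ℓ and 2 ^ ℓ singletons.
module Submission where

open import Defs
open import Data.Bool using (true; false; T; if_then_else_)
open import Data.Bool.Properties using (T?)
open import Data.Empty using (⊥-elim)
open import Data.Fin using (Fin; toℕ; fromℕ<)
import Data.Fin.Properties as Fin
import Data.Integer as ℤ
import Data.Integer.Properties as ℤ
open import Data.List using (List; []; _∷_; _++_; length; map; filterᵇ; cartesianProduct; allFin)
open import Data.List.Properties using (length-++; map-++; ++-assoc; filter-++)
open import Data.List.Membership.Propositional using (_∈_)
open import Data.List.Membership.Propositional.Properties using (∈-++⁺ˡ; ∈-++⁺ʳ; ∈-++⁻; ∈-allFin)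
import Data.List.Membership.DecPropositional as DecMembership
open import Data.List.Relation.Unary.Any using (here; there)
open import Data.List.Relation.Binary.Permutation.Propositional using (_↭_; ↭-refl; ↭-sym; ↭-trans; ↭-prep; ↭-reflexive)
open import Data.List.Relation.Binary.Permutation.Propositional.Properties using (∈-resp-↭; ↭-length; ++⁺ˡ; ++⁺ʳ; ++⁺; ++-comm; shift; map⁺)
open import Data.Nat
open import Data.Nat.DivMod using (m≡m%n+[m/n]*n; m%n<n; m/n*n≤m; m*n/n≡m; m<n*o⇒m/o<n; /-monoˡ-≤)
open import Data.Nat.ListAction using (sum)
open import Data.Nat.ListAction.Properties using (sum-++; sum-↭)
open import Data.Nat.Properties
open import Data.Nat.Tactic.RingSolver using (solve-∀)
open import Data.Product using (Σ; ∃; ∃₂; _×_; _,_; proj₁; proj₂; uncurry)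
open import Data.Rational using (ℚ; 0ℚ)
import Data.Rational as ℚ
import Data.Rational.Properties as ℚ
open import Data.Rational.Unnormalised as ℚᵘ using (mkℚᵘ; *≡*; *≤*)
import Data.Rational.Unnormalised.Properties as ℚᵘ
open import Data.Sum using (_⊎_; inj₁; inj₂)
open import Function using (_∘_)
open import Level using (0ℓ)
open import Relation.Binary.Definitions using (tri<; tri≈; tri>)
open import Relation.Binary.PropositionalEquality using (_≡_; refl; sym; trans; cong; cong₂; subst; subst₂; module ≡-Reasoning)
open import Relation.Nullary using (¬_; yes; no)
open import Relation.Unary using (Pred; Decidable)

open OrientedGraph using (order; size)

-- Finite sums over lists, and rearrangements of lists

Σ[_]_ : {A : Set} → List A → (A → ℕ) → ℕ
Σ[ xs ] f = sum (map f xs)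

infix 5 Σ[_]_

module _ {A : Set} where

  Σ-++ : (f : A → ℕ) (xs ys : List A) → Σ[ xs ++ ys ] f ≡ (Σ[ xs ] f) + (Σ[ ys ] f)
  Σ-++ f xs ys = trans (cong sum (map-++ f xs ys)) (sum-++ (map f xs) (map f ys))

  Σ-↭ : (f : A → ℕ) {xs ys : List A} → xs ↭ ys → Σ[ xs ] f ≡ Σ[ ys ] f
  Σ-↭ f p = sum-↭ (map⁺ f p)

  Σ-cong : {f g : A → ℕ} → (∀ x → f x ≡ g x) → (xs : List A) → Σ[ xs ] f ≡ Σ[ xs ] g
  Σ-cong f≡g []       = refl
  Σ-cong f≡g (x ∷ xs) = cong₂ _+_ (f≡g x) (Σ-cong f≡g xs)

  Σ-zero : (xs : List A) → Σ[ xs ] (λ _ → 0) ≡ 0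
  Σ-zero []       = refl
  Σ-zero (x ∷ xs) = Σ-zero xs

  Σ-+ : (f g : A → ℕ) (xs : List A) → Σ[ xs ] (λ x → f x + g x) ≡ (Σ[ xs ] f) + (Σ[ xs ] g)
  Σ-+ f g []       = refl
  Σ-+ f g (x ∷ xs) = trans (cong (f x + g x +_) (Σ-+ f g xs)) (lemma (f x) (g x) (Σ[ xs ] f) (Σ[ xs ] g))
    where
    lemma : ∀ a b c d → a + b + (c + d) ≡ a + c + (b + d)
    lemma = solve-∀

  Σ-const-≤ : (c : ℕ) (f : A → ℕ) (xs : List A) → (∀ {x} → x ∈ xs → c ≤ f x) → length xs * c ≤ Σ[ xs ] f
  Σ-const-≤ c f []       c≤f = z≤n
  Σ-const-≤ c f (x ∷ xs) c≤f = +-mono-≤ (c≤f (here refl)) (Σ-const-≤ c f xs (c≤f ∘ there))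

  Σ-∈ : (f : A → ℕ) {x : A} {xs : List A} → x ∈ xs → f x ≤ Σ[ xs ] f
  Σ-∈ f {x} {_ ∷ xs} (here refl) = m≤m+n (f x) _
  Σ-∈ f {x} {y ∷ xs} (there x∈)  = ≤-trans (Σ-∈ f x∈) (m≤n+m _ (f y))

  Σ-swap : (f : A → A → ℕ) (xs ys : List A) →
           Σ[ xs ] (λ x → Σ[ ys ] f x) ≡ Σ[ ys ] (λ y → Σ[ xs ] λ x → f x y)
  Σ-swap f []       ys = sym (Σ-zero ys)
  Σ-swap f (x ∷ xs) ys = trans (cong ((Σ[ ys ] f x) +_) (Σ-swap f xs ys)) (sym (Σ-+ (f x) _ ys))

  length-↭-++ : {xs : List A} (ys zs : List A) → xs ↭ ys ++ zs → length xs ≡ length ys + length zs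
  length-↭-++ ys zs p = trans (↭-length p) (length-++ ys)

  ↭-++-assoc : {xs zs ws : List A} (ys : List A) → xs ↭ ys ++ zs → xs ++ ws ↭ ys ++ (zs ++ ws)
  ↭-++-assoc {zs = zs} {ws} ys p = ↭-trans (++⁺ʳ ws p) (↭-reflexive (++-assoc ys zs ws))

  ∈-left : {x : A} {xs ys zs : List A} → xs ↭ ys ++ zs → x ∈ ys → x ∈ xs
  ∈-left p x∈ = ∈-resp-↭ (↭-sym p) (∈-++⁺ˡ x∈)

  ∈-right : {x : A} {xs zs : List A} (ys : List A) → xs ↭ ys ++ zs → x ∈ zs → x ∈ xs
  ∈-right ys p x∈ = ∈-resp-↭ (↭-sym p) (∈-++⁺ʳ ys x∈)

  splitBy : {P : Pred A 0ℓ} → Decidable P → (xs : List A) →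
            ∃₂ λ ys zs → xs ↭ ys ++ zs × (∀ {x} → x ∈ ys → P x) × (∀ {x} → x ∈ zs → ¬ P x)
  splitBy P? [] = [] , [] , ↭-refl , (λ ()) , (λ ())
  splitBy P? (x ∷ xs) with splitBy P? xs | P? x
  ... | ys , zs , p , Pys , ¬Pzs | yes px =
    x ∷ ys , zs , ↭-prep x p , (λ { (here refl) → px ; (there y∈) → Pys y∈ }) , ¬Pzs
  ... | ys , zs , p , Pys , ¬Pzs | no ¬px =
    ys , x ∷ zs , ↭-trans (↭-prep x p) (↭-sym (shift x ys zs)) , Pys ,
    (λ { (here refl) → ¬px ; (there y∈) → ¬Pzs y∈ })

-- Degrees, arcs and acyclic vertex sets of bounded height

module _ (G : OrientedGraph) where

  open OrientedGraph G using (edge; _⟶_; loopless; oriented)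
  open DecMembership (Fin._≟_ {order G}) using (_∈?_)

  private
    V : Set
    V = Fin (order G)

  E : V → V → ℕ
  E x y = if edge x y then 1 else 0

  E≡0⇒¬⟶ : ∀ {x y} → E x y ≡ 0 → ¬ (x ⟶ y)
  E≡0⇒¬⟶ {x} {y} E≡0 x⟶y with edge x y
  E≡0⇒¬⟶ () x⟶y | true

  adj : V → V → ℕ
  adj x y = E x y + E y x

  adj≡0⇒¬⟶ : ∀ {x y} → adj x y ≡ 0 → ¬ (x ⟶ y)
  adj≡0⇒¬⟶ {x} {y} eq = E≡0⇒¬⟶ (m+n≡0⇒m≡0 (E x y) eq)

  adj≡0⇒¬⟵ : ∀ {x y} → adj x y ≡ 0 → ¬ (y ⟶ x)
  adj≡0⇒¬⟵ {x} {y} eq = E≡0⇒¬⟶ (m+n≡0⇒n≡0 (E x y) eq)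

  deg : List V → V → ℕ
  deg I x = Σ[ I ] adj x

  arcs : List V → List V → ℕ
  arcs P Q = Σ[ P ] λ x → Σ[ Q ] E x

  arcs-↭ : ∀ {P Q} → P ↭ Q → arcs P P ≡ arcs Q Q
  arcs-↭ {P} {Q} p = trans (Σ-cong (λ x → Σ-↭ (E x) p) P) (Σ-↭ _ p)

  arcs-cross : ∀ P Q → arcs P Q + arcs Q P ≡ Σ[ Q ] deg P
  arcs-cross P Q = begin
    arcs P Q + arcs Q P                                ≡⟨ cong (_+ arcs Q P) (Σ-swap E P Q) ⟩
    (Σ[ Q ] λ x → Σ[ P ] λ y → E y x) + arcs Q P       ≡⟨ +-comm _ (arcs Q P) ⟩
    arcs Q P + (Σ[ Q ] λ x → Σ[ P ] λ y → E y x)       ≡⟨ Σ-+ (λ x → Σ[ P ] E x) (λ x → Σ[ P ] λ y → E y x) Q ⟨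
    Σ[ Q ] (λ x → (Σ[ P ] E x) + (Σ[ P ] λ y → E y x)) ≡⟨ Σ-cong (λ x → sym (Σ-+ (E x) (λ y → E y x) P)) Q ⟩
    Σ[ Q ] deg P                                       ∎
    where open ≡-Reasoning

  -- The arcs within `R` are of four kinds by the sides of their ends. Those inside `P` are given
  -- up, and the two crossing kinds add up to the degrees into `P`.
  arcs-split : ∀ {R} P Q → R ↭ P ++ Q → arcs Q Q + (Σ[ Q ] deg P) ≤ arcs R R
  arcs-split {R} P Q p = begin
    arcs Q Q + (Σ[ Q ] deg P)                     ≡⟨ cong (arcs Q Q +_) (arcs-cross P Q) ⟨
    arcs Q Q + (arcs P Q + arcs Q P)              ≤⟨ m≤n+m _ (arcs P P) ⟩
    arcs P P + (arcs Q Q + (arcs P Q + arcs Q P)) ≡⟨ lemma (arcs P P) (arcs Q Q) (arcs P Q) (arcs Q P) ⟩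
    (arcs P P + arcs P Q) + (arcs Q P + arcs Q Q) ≡⟨ cong₂ _+_ (distrib P) (distrib Q) ⟩
    arcs P (P ++ Q) + arcs Q (P ++ Q)             ≡⟨ Σ-++ _ P Q ⟨
    arcs (P ++ Q) (P ++ Q)                        ≡⟨ arcs-↭ p ⟨
    arcs R R                                      ∎
    where
    open ≤-Reasoning
    lemma : ∀ a b c d → a + (b + (c + d)) ≡ (a + c) + (d + b)
    lemma = solve-∀
    distrib : ∀ X → arcs X P + arcs X Q ≡ arcs X (P ++ Q)
    distrib X = trans (sym (Σ-+ (λ x → Σ[ P ] E x) (λ x → Σ[ Q ] E x) X)) (Σ-cong (λ x → sym (Σ-++ (E x) P Q)) X)

  arcs-size : arcs (allFin _) (allFin _) ≡ size G
  arcs-size = sym (pairs (allFin _) (allFin _))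
    where
    row : ∀ x ys → length (filterᵇ (uncurry edge) (map (x ,_) ys)) ≡ Σ[ ys ] E x
    row x []       = refl
    row x (y ∷ ys) with edge x y
    ... | true  = cong suc (row x ys)
    ... | false = row x ys
    pairs : ∀ xs ys → length (filterᵇ (uncurry edge) (cartesianProduct xs ys)) ≡ arcs xs ys
    pairs []       ys = refl
    pairs (x ∷ xs) ys = begin
      length (filterᵇ _ (map (x ,_) ys ++ cartesianProduct xs ys))
        ≡⟨ cong length (filter-++ (T? ∘ uncurry edge) (map (x ,_) ys) _) ⟩
      length (filterᵇ _ (map (x ,_) ys) ++ filterᵇ _ (cartesianProduct xs ys))
        ≡⟨ length-++ (filterᵇ _ (map (x ,_) ys)) ⟩
      length (filterᵇ _ (map (x ,_) ys)) + length (filterᵇ _ (cartesianProduct xs ys))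
        ≡⟨ cong₂ _+_ (row x ys) (pairs xs ys) ⟩
      arcs (x ∷ xs) ys ∎
      where open ≡-Reasoning

  -- A level function certifies at once that `I` is acyclic and that its paths have at most `ℓ`
  -- vertices, and it is easier to glue than a condition on paths.
  record Levelled (ℓ : ℕ) (I : List V) : Set where
    field
      lev  : V → ℕ
      lev< : ∀ {x} → x ∈ I → lev x < ℓ
      rise : ∀ {x y} → x ∈ I → y ∈ I → x ⟶ y → lev x < lev y

  -- One pair of functions describes all classes together, so that the digits of class and level can
  -- later be read off vertex by vertex.
  record Layered (ℓ M : ℕ) (R : List V) : Set where
    field
      cls  : V → ℕ
      lev  : V → ℕ
      cls< : ∀ {x} → x ∈ R → cls x < M
      lev< : ∀ {x} → x ∈ R → lev x < ℓ
      rise : ∀ {x y} → x ∈ R → y ∈ R → x ⟶ y → cls x ≡ cls y → lev x < lev y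

  module _ {ℓ : ℕ} where

    levelled-⊆ : ∀ {I J} → (∀ {x} → x ∈ J → x ∈ I) → Levelled ℓ I → Levelled ℓ J
    levelled-⊆ J⊆I L = record { lev = lev ; lev< = lev< ∘ J⊆I ; rise = λ x∈ y∈ → rise (J⊆I x∈) (J⊆I y∈) }
      where open Levelled L

    -- No edge joins the two sets, so their levels need no adjustment and the height does not grow.
    -- On a vertex of both sets the level from `J` wins.
    levelled-++ : ∀ {I J} → Levelled ℓ I → Levelled ℓ J →
                  (∀ {x y} → x ∈ J → y ∈ I → adj x y ≡ 0) → Levelled ℓ (I ++ J)
    levelled-++ {I} {J} L K sep = record { lev = lev ; lev< = lev< ; rise = rise }
      where
      module L = Levelled L
      module K = Levelled K
      lev : V → ℕ
      lev x with x ∈? J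
      ... | yes _ = K.lev x
      ... | no  _ = L.lev x
      left : ∀ {x} → x ∈ I ++ J → ¬ x ∈ J → x ∈ I
      left x∈ x∉J with ∈-++⁻ I x∈
      ... | inj₁ x∈I = x∈I
      ... | inj₂ x∈J = ⊥-elim (x∉J x∈J)
      lev< : ∀ {x} → x ∈ I ++ J → lev x < ℓ
      lev< {x} x∈ with x ∈? J
      ... | yes x∈J = K.lev< x∈J
      ... | no  x∉J = L.lev< (left x∈ x∉J)
      rise : ∀ {x y} → x ∈ I ++ J → y ∈ I ++ J → x ⟶ y → lev x < lev y
      rise {x} {y} x∈ y∈ x⟶y with x ∈? J | y ∈? J
      ... | yes x∈J | yes y∈J = K.rise x∈J y∈J x⟶y
      ... | yes x∈J | no  y∉J = ⊥-elim (adj≡0⇒¬⟶ (sep x∈J (left y∈ y∉J)) x⟶y)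
      ... | no  x∉J | yes y∈J = ⊥-elim (adj≡0⇒¬⟵ (sep y∈J (left x∈ x∉J)) x⟶y)
      ... | no  x∉J | no  y∉J = L.rise (left x∈ x∉J) (left y∈ y∉J) x⟶y

    layered-[] : Layered ℓ 0 []
    layered-[] = record { cls = λ _ → 0 ; lev = λ _ → 0 ; cls< = λ () ; lev< = λ () ; rise = λ () }

    -- The new class number `M` exceeds all those used on `Q`, so edges between the new class and
    -- the old ones impose nothing on the levels.
    addClass : ∀ {M R} I Q → R ↭ I ++ Q → Levelled ℓ I → Layered ℓ M Q → Layered ℓ (suc M) R
    addClass {M} {R} I Q p L K = record { cls = cls ; lev = lev ; cls< = cls< ; lev< = lev< ; rise = rise }
      where
      module L = Levelled L
      module K = Layered K
      cls lev : V → ℕ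
      cls x with x ∈? I
      ... | yes _ = M
      ... | no  _ = K.cls x
      lev x with x ∈? I
      ... | yes _ = L.lev x
      ... | no  _ = K.lev x
      rest : ∀ {x} → x ∈ R → ¬ x ∈ I → x ∈ Q
      rest x∈ x∉I with ∈-++⁻ I (∈-resp-↭ p x∈)
      ... | inj₁ x∈I = ⊥-elim (x∉I x∈I)
      ... | inj₂ x∈Q = x∈Q
      cls< : ∀ {x} → x ∈ R → cls x < suc M
      cls< {x} x∈ with x ∈? I
      ... | yes _   = n<1+n M
      ... | no  x∉I = m<n⇒m<1+n (K.cls< (rest x∈ x∉I))
      lev< : ∀ {x} → x ∈ R → lev x < ℓ
      lev< {x} x∈ with x ∈? I
      ... | yes x∈I = L.lev< x∈I
      ... | no  x∉I = K.lev< (rest x∈ x∉I)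
      rise : ∀ {x y} → x ∈ R → y ∈ R → x ⟶ y → cls x ≡ cls y → lev x < lev y
      rise {x} {y} x∈ y∈ x⟶y eq with x ∈? I | y ∈? I
      ... | yes x∈I | yes y∈I = L.rise x∈I y∈I x⟶y
      ... | yes x∈I | no  y∉I = ⊥-elim (<-irrefl (sym eq) (K.cls< (rest y∈ y∉I)))
      ... | no  x∉I | yes y∈I = ⊥-elim (<-irrefl eq (K.cls< (rest x∈ x∉I)))
      ... | no  x∉I | no  y∉I = K.rise (rest x∈ x∉I) (rest y∈ y∉I) x⟶y eq

  independent⇒levelled : ∀ {ℓ I} → 1 ≤ ℓ → (∀ {x y} → x ∈ I → y ∈ I → adj x y ≡ 0) → Levelled ℓ I
  independent⇒levelled 1≤ℓ ind = record
    { lev = λ _ → 0 ; lev< = λ _ → 1≤ℓ ; rise = λ x∈ y∈ x⟶y → ⊥-elim (adj≡0⇒¬⟶ (ind x∈ y∈) x⟶y) }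

  adj-self : ∀ x → adj x x ≡ 0
  adj-self x with edge x x in eq
  ... | true  = ⊥-elim (loopless {x} refl (subst T (sym eq) _))
  ... | false = refl

  adj-sym : ∀ x y → adj x y ≡ adj y x
  adj-sym x y = +-comm (E x y) (E y x)

  -- Greedy choice. Maximality appears as domination, by which the removal of `I` destroys at least
  -- one edge for every vertex that remains.
  maximalIndependent : ∀ R → ∃₂ λ I Q → R ↭ I ++ Q ×
    (∀ {x y} → x ∈ I → y ∈ I → adj x y ≡ 0) × (∀ {x} → x ∈ Q → 1 ≤ deg I x)
  maximalIndependent [] = [] , [] , ↭-refl , (λ ()) , (λ ())
  maximalIndependent (v ∷ R) with maximalIndependent R
  ... | I , Q , p , ind , dom with deg I v in eq
  ... | zero = v ∷ I , Q , ↭-prep v p , ind′ , λ x∈ → ≤-trans (dom x∈) (m≤n+m _ (adj _ v))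
    where
    v-ind : ∀ {y} → y ∈ I → adj v y ≡ 0
    v-ind y∈ = n≤0⇒n≡0 (≤-trans (Σ-∈ (adj v) y∈) (≤-reflexive eq))
    ind′ : ∀ {x y} → x ∈ v ∷ I → y ∈ v ∷ I → adj x y ≡ 0
    ind′ (here refl) (here refl) = adj-self v
    ind′ (here refl) (there y∈)  = v-ind y∈
    ind′ (there x∈)  (here refl) = trans (adj-sym _ v) (v-ind x∈)
    ind′ (there x∈)  (there y∈)  = ind x∈ y∈
  ... | suc d = I , v ∷ Q , ↭-trans (↭-prep v p) (↭-sym (shift v I Q)) , ind ,
    λ { (here refl) → subst (1 ≤_) (sym eq) (s≤s z≤n) ; (there x∈) → dom x∈ }

  levelled-∷-low : ∀ {ℓ v Y} → (∀ {x} → x ∈ Y → ¬ (x ⟶ v)) → Levelled ℓ Y → Levelled (suc ℓ) (v ∷ Y)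
  levelled-∷-low {ℓ} {v} {Y} notToV L = record { lev = lev ; lev< = lev< ; rise = rise }
    where
    module L = Levelled L
    lev : V → ℕ
    lev x with x Fin.≟ v
    ... | yes _ = 0
    ... | no  _ = suc (L.lev x)
    lev< : ∀ {x} → x ∈ v ∷ Y → lev x < suc ℓ
    lev< {x} x∈ with x Fin.≟ v | x∈
    ... | yes _  | _         = s≤s z≤n
    ... | no x≢v | here eq   = ⊥-elim (x≢v eq)
    ... | no _   | there x∈Y = s≤s (L.lev< x∈Y)
    rise : ∀ {x y} → x ∈ v ∷ Y → y ∈ v ∷ Y → x ⟶ y → lev x < lev y
    rise {x} {y} x∈ y∈ x⟶y with x Fin.≟ v | y Fin.≟ v | x∈ | y∈
    ... | yes refl | yes refl | _         | _         = ⊥-elim (loopless {x} refl x⟶y)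
    ... | yes _    | no _     | _         | _         = s≤s z≤n
    ... | no x≢v   | _        | here eq   | _         = ⊥-elim (x≢v eq)
    ... | no _     | yes refl | there x∈Y | _         = ⊥-elim (notToV x∈Y x⟶y)
    ... | no _     | no y≢v   | there _   | here eq   = ⊥-elim (y≢v eq)
    ... | no _     | no _     | there x∈Y | there y∈Y = s≤s (L.rise x∈Y y∈Y x⟶y)

  levelled-∷-high : ∀ {ℓ v Y} → (∀ {x} → x ∈ Y → ¬ (v ⟶ x)) → Levelled ℓ Y → Levelled (suc ℓ) (v ∷ Y)
  levelled-∷-high {ℓ} {v} {Y} notFromV L = record { lev = lev ; lev< = lev< ; rise = rise }
    where
    module L = Levelled L
    lev : V → ℕ
    lev x with x Fin.≟ v
    ... | yes _ = ℓ
    ... | no  _ = L.lev x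
    lev< : ∀ {x} → x ∈ v ∷ Y → lev x < suc ℓ
    lev< {x} x∈ with x Fin.≟ v | x∈
    ... | yes _  | _         = n<1+n ℓ
    ... | no x≢v | here eq   = ⊥-elim (x≢v eq)
    ... | no _   | there x∈Y = m<n⇒m<1+n (L.lev< x∈Y)
    rise : ∀ {x y} → x ∈ v ∷ Y → y ∈ v ∷ Y → x ⟶ y → lev x < lev y
    rise {x} {y} x∈ y∈ x⟶y with x Fin.≟ v | y Fin.≟ v | x∈ | y∈
    ... | yes refl | yes refl | _         | _         = ⊥-elim (loopless {x} refl x⟶y)
    ... | yes refl | no y≢v   | _         | here eq   = ⊥-elim (y≢v eq)
    ... | yes refl | no _     | _         | there y∈Y = ⊥-elim (notFromV y∈Y x⟶y)
    ... | no x≢v   | _        | here eq   | _         = ⊥-elim (x≢v eq)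
    ... | no _     | yes _    | there x∈Y | _         = L.lev< x∈Y
    ... | no _     | no y≢v   | there _   | here eq   = ⊥-elim (y≢v eq)
    ... | no _     | no _     | there x∈Y | there y∈Y = L.rise x∈Y y∈Y x⟶y

  -- The Erdős-Moser argument, with the non-neighbours of `v` treated as out-neighbours. If `v` has
  -- `2 ^ ℓ` in-neighbours, it goes on top of a set found among them; otherwise it goes below a set
  -- found among the other vertices.
  transitive : ∀ ℓ X → 2 ^ ℓ ≤ length X → ∃₂ λ Y W → X ↭ Y ++ W × length Y ≡ ℓ × Levelled ℓ Y
  transitive zero    X       _   = [] , X , ↭-refl , refl , record { lev = λ _ → 0 ; lev< = λ () ; rise = λ () }
  transitive (suc ℓ) []      2^≤ = ⊥-elim (<-irrefl refl (≤-trans (m^n>0 2 (suc ℓ)) 2^≤))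
  transitive (suc ℓ) (v ∷ X) 2^≤ with splitBy (λ x → T? (edge x v)) X
  ... | A , B , p , toV , notToV with 2 ^ ℓ ≤? length A
  ...   | yes 2^≤A with transitive ℓ A 2^≤A
  ...     | Y , W , q , |Y| , L =
    v ∷ Y , W ++ B , ↭-prep v (↭-trans p (↭-++-assoc Y q)) , cong suc |Y| ,
    levelled-∷-high (λ x∈ v⟶x → oriented v⟶x (toV (∈-left q x∈))) L
  transitive (suc ℓ) (v ∷ X) 2^≤ | A , B , p , toV , notToV | no 2^≰A with transitive ℓ B 2^≤B
    where
    -- `A` has fewer than `2 ^ ℓ` vertices, so `A` and `v` together have at most `2 ^ ℓ`, half of
    -- the total required.
    2^≤B : 2 ^ ℓ ≤ length B
    2^≤B = +-cancelˡ-≤ (2 ^ ℓ) _ _ (begin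
      2 ^ ℓ + 2 ^ ℓ             ≡⟨ cong (2 ^ ℓ +_) (+-identityʳ _) ⟨
      2 ^ suc ℓ                 ≤⟨ 2^≤ ⟩
      suc (length X)            ≡⟨ cong suc (length-↭-++ A B p) ⟩
      suc (length A) + length B ≤⟨ +-monoˡ-≤ (length B) (≰⇒> 2^≰A) ⟩
      2 ^ ℓ + length B          ∎)
      where open ≤-Reasoning
  ...   | Y , W , q , |Y| , L =
    v ∷ Y , W ++ A , ↭-prep v (↭-trans p (↭-trans (++-comm A B) (↭-++-assoc Y q))) , cong suc |Y| ,
    levelled-∷-low (λ x∈ → notToV (∈-left q x∈)) L

-- Counting small subsets

n<2^n : ∀ n → n < 2 ^ n
n<2^n zero    = s≤s z≤n
n<2^n (suc n) = begin-strict
  suc n         ≤⟨ n<2^n n ⟩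
  2 ^ n         <⟨ m<m+n (2 ^ n) (m^n>0 2 n) ⟩
  2 ^ n + 2 ^ n ≡⟨ cong (2 ^ n +_) (+-identityʳ _) ⟨
  2 ^ suc n     ∎
  where open ≤-Reasoning

-- The number of subsets of size at most D of a set of size s.
subsets : ℕ → ℕ → ℕ
subsets zero    D       = 1
subsets (suc s) zero    = 1
subsets (suc s) (suc D) = subsets s (suc D) + subsets s D

subsets-suc : ∀ s D → subsets s D ≤ subsets (suc s) D
subsets-suc zero    zero    = ≤-refl
subsets-suc (suc s) zero    = ≤-refl
subsets-suc s       (suc D) = m≤m+n _ _

subsets-mono : ∀ {s t} D → s ≤ t → subsets s D ≤ subsets t D
subsets-mono {s} D s≤t = go (≤⇒≤′ s≤t)
  where
  go : ∀ {t} → s ≤′ t → subsets s D ≤ subsets t D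
  go (≤′-reflexive refl) = ≤-refl
  go (≤′-step p)         = ≤-trans (go p) (subsets-suc _ D)

-- Divided by `q ^ s`, this bounds the count by (1 + 1/q)^s (q + 1)^D, as comes from giving a subset
-- of size i the weight q^(-i). The induction follows Pascal's recursion.
subsets-* : ∀ q s D → subsets s D * q ^ s ≤ suc q ^ (s + D)
subsets-* q zero    D       = m^n>0 (suc q) D
subsets-* q (suc s) zero    = begin
  1 * q ^ suc s       ≡⟨ *-identityˡ _ ⟩
  q ^ suc s           ≤⟨ ^-monoˡ-≤ (suc s) (n≤1+n q) ⟩
  suc q ^ suc s       ≡⟨ cong (suc q ^_) (+-identityʳ (suc s)) ⟨
  suc q ^ (suc s + 0) ∎
  where open ≤-Reasoning
subsets-* q (suc s) (suc D) = begin
  (subsets s (suc D) + subsets s D) * (q * q ^ s)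
    ≡⟨ expand (subsets s (suc D)) (subsets s D) q (q ^ s) ⟩
  q * (subsets s (suc D) * q ^ s) + q * (subsets s D * q ^ s)
    ≤⟨ +-mono-≤ (*-monoʳ-≤ q (subsets-* q s (suc D))) (*-mono-≤ (n≤1+n q) (subsets-* q s D)) ⟩
  q * suc q ^ (s + suc D) + suc q ^ suc (s + D)
    ≡⟨ cong (λ m → q * suc q ^ (s + suc D) + suc q ^ m) (+-suc s D) ⟨
  q * suc q ^ (s + suc D) + suc q ^ (s + suc D)
    ≡⟨ +-comm (q * suc q ^ (s + suc D)) _ ⟩
  suc q ^ (suc s + suc D) ∎
  where
  open ≤-Reasoning
  expand : ∀ a b q x → (a + b) * (q * x) ≡ q * (a * x) + q * (b * x)
  expand = solve-∀

-- Bernoulli's inequality (1 - 1/Q)^j ≥ 1 - j/Q for Q = q + 1, with denominators cleared.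
bernoulli : ∀ q j r → r + j ≡ suc q → r * suc q ^ j ≤ q ^ j * suc q
bernoulli q zero r eq = begin
  r * 1     ≡⟨ *-identityʳ r ⟩
  r         ≡⟨ trans (sym (+-identityʳ r)) eq ⟩
  suc q     ≡⟨ *-identityˡ (suc q) ⟨
  1 * suc q ∎
  where open ≤-Reasoning
bernoulli q (suc j) r eq = begin
  r * (suc q * suc q ^ j) ≡⟨ *-assoc r (suc q) _ ⟨
  r * suc q * suc q ^ j   ≤⟨ *-monoˡ-≤ (suc q ^ j) rQ≤ ⟩
  q * suc r * suc q ^ j   ≡⟨ *-assoc q (suc r) _ ⟩
  q * (suc r * suc q ^ j) ≤⟨ *-monoʳ-≤ q (bernoulli q j (suc r) (trans (sym (+-suc r j)) eq)) ⟩
  q * (q ^ j * suc q)     ≡⟨ *-assoc q (q ^ j) _ ⟨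
  q * q ^ j * suc q       ∎
  where
  open ≤-Reasoning
  r≤q : r ≤ q
  r≤q = s≤s⁻¹ (≤-trans (s≤s (m≤m+n r j)) (≤-reflexive (trans (sym (+-suc r j)) eq)))
  rQ≤ : r * suc q ≤ q * suc r
  rQ≤ = begin
    r * suc q ≡⟨ *-suc r q ⟩
    r + r * q ≤⟨ +-monoˡ-≤ (r * q) r≤q ⟩
    q + r * q ≡⟨ cong (q +_) (*-comm r q) ⟩
    q + q * r ≡⟨ *-suc q r ⟨
    q * suc r ∎

-- The case j = Q/2, to be read as (1 + 1/q)^h ≤ 2.
bernoulli-half : ∀ q h → 1 ≤ h → suc q ≡ h + h → suc q ^ h ≤ 2 * q ^ h
bernoulli-half q h@(suc _) _ eq = *-cancelˡ-≤ h (begin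
  h * suc q ^ h   ≤⟨ bernoulli q h h (sym eq) ⟩
  q ^ h * suc q   ≡⟨ cong (q ^ h *_) eq ⟩
  q ^ h * (h + h) ≡⟨ rearrange (q ^ h) h ⟩
  h * (2 * q ^ h) ∎)
  where
  open ≤-Reasoning
  rearrange : ∀ x h → x * (h + h) ≡ h * (2 * x)
  rearrange = solve-∀

^-distribʳ-* : ∀ m n o → (m * n) ^ o ≡ m ^ o * n ^ o
^-distribʳ-* m n zero    = refl
^-distribʳ-* m n (suc o) = trans (cong (m * n *_) (^-distribʳ-* m n o)) (swap m n (m ^ o) (n ^ o))
  where
  swap : ∀ a b c d → a * b * (c * d) ≡ a * c * (b * d)
  swap = solve-∀

-- Put q + 1 = 2^d = 2h in `subsets-*`: then (1 + 1/q)^(hℓ) ≤ 2^ℓ, and (q + 1)^D = 2^(dD) ≤ 2^ℓ. So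
-- a set much larger than `ℓ` still has only 4^ℓ possible small traces.
subsets-bound : ∀ ℓ h d D → 2 ≤ h → 2 ^ d ≡ h + h → D * d ≤ ℓ → subsets (h * ℓ) D ≤ 2 ^ ℓ * 2 ^ ℓ
subsets-bound ℓ h d D 2≤h 2^d≡ Dd≤ℓ = bound (pred (2 ^ d)) (suc-pred (2 ^ d) {{m^n≢0 2 d}})
  where
  open ≤-Reasoning
  bound : ∀ q → suc q ≡ 2 ^ d → subsets (h * ℓ) D ≤ 2 ^ ℓ * 2 ^ ℓ
  bound zero      eq = ⊥-elim (<⇒≢ (≤-trans (s≤s (s≤s z≤n)) (+-mono-≤ 2≤h (z≤n {h}))) (trans eq 2^d≡))
  bound q@(suc _) eq = *-cancelʳ-≤ _ _ (q ^ (h * ℓ)) {{m^n≢0 q (h * ℓ)}} (begin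
    subsets (h * ℓ) D * q ^ (h * ℓ) ≤⟨ subsets-* q (h * ℓ) D ⟩
    suc q ^ (h * ℓ + D)             ≡⟨ ^-distribˡ-+-* (suc q) (h * ℓ) D ⟩
    suc q ^ (h * ℓ) * suc q ^ D     ≡⟨ cong (_* suc q ^ D) (^-*-assoc (suc q) h ℓ) ⟨
    (suc q ^ h) ^ ℓ * suc q ^ D
      ≤⟨ *-mono-≤ (^-monoˡ-≤ ℓ (bernoulli-half q h (≤-trans (s≤s z≤n) 2≤h) (trans eq 2^d≡))) lastFactor ⟩
    (2 * q ^ h) ^ ℓ * 2 ^ ℓ     ≡⟨ cong (_* 2 ^ ℓ) (^-distribʳ-* 2 (q ^ h) ℓ) ⟩
    2 ^ ℓ * (q ^ h) ^ ℓ * 2 ^ ℓ ≡⟨ cong (λ x → 2 ^ ℓ * x * 2 ^ ℓ) (^-*-assoc q h ℓ) ⟩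
    2 ^ ℓ * q ^ (h * ℓ) * 2 ^ ℓ ≡⟨ swap (2 ^ ℓ) (q ^ (h * ℓ)) ⟩
    2 ^ ℓ * 2 ^ ℓ * q ^ (h * ℓ) ∎)
    where
    swap : ∀ a b → a * b * a ≡ a * a * b
    swap = solve-∀
    lastFactor : suc q ^ D ≤ 2 ^ ℓ
    lastFactor = begin
      suc q ^ D   ≡⟨ cong (_^ D) eq ⟩
      (2 ^ d) ^ D ≡⟨ ^-*-assoc 2 d D ⟩
      2 ^ (d * D) ≤⟨ ^-monoʳ-≤ 2 (≤-trans (≤-reflexive (*-comm d D)) Dd≤ℓ) ⟩
      2 ^ ℓ       ∎

-- The witness is the integer part of the base-`b` logarithm of r / N, searched for downwards from
-- `f`.
bracket : ∀ b N r f → N ≤ r → r < b ^ f * N → ∃ λ t → t < f × b ^ t * N ≤ r × r < b ^ suc t * N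
bracket b N r zero    N≤r r< = ⊥-elim (<⇒≱ r< (≤-trans (≤-reflexive (*-identityˡ N)) N≤r))
bracket b N r (suc f) N≤r r< with r <? b ^ f * N
... | no r≮   = f , n<1+n f , ≮⇒≥ r≮ , r<
... | yes r<′ with bracket b N r f N≤r r<′
...   | t , t<f , lo , hi = t , m<n⇒m<1+n t<f , lo , hi

-- Extraction of one large acyclic set

module _ (G : OrientedGraph) where

  private
    V : Set
    V = Fin (order G)

  -- All neighbours that `Z` has in `I` lie in the small part `J`, so `J` may be exchanged for an
  -- acyclic subset of `Z`.
  record SameTrace (T D : ℕ) (I X : List V) : Set where
    field
      I′ J Z W : List V
      I↭      : I ↭ I′ ++ J
      |J|≤    : length J ≤ D
      X↭      : X ↭ Z ++ W
      T≤|Z|   : T ≤ length Z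
      nonadj  : ∀ {x y} → x ∈ Z → y ∈ I′ → adj G x y ≡ 0

  -- Pigeonhole over the possible neighbourhoods in `I`, carried out along Pascal's recursion. For
  -- each `i`, either its non-neighbours are kept and `i` enters `I′`, or its neighbours are kept,
  -- `i` enters `J` and the degree allowance drops by one.
  sameTrace : ∀ T D I X → (∀ {x} → x ∈ X → deg G I x ≤ D) →
              T * subsets (length I) D ≤ length X → SameTrace T D I X
  sameTrace T D [] X deg≤ T≤ = record
    { I′ = [] ; J = [] ; Z = X ; W = [] ; I↭ = ↭-refl ; |J|≤ = z≤n ; X↭ = ++-comm [] X
    ; T≤|Z| = ≤-trans (≤-reflexive (sym (*-identityʳ T))) T≤ ; nonadj = λ _ () }
  sameTrace T zero (i ∷ I) X deg≤ T≤ = record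
    { I′ = i ∷ I ; J = [] ; Z = X ; W = [] ; I↭ = ++-comm [] (i ∷ I) ; |J|≤ = z≤n ; X↭ = ++-comm [] X
    ; T≤|Z| = ≤-trans (≤-reflexive (sym (*-identityʳ T))) T≤
    ; nonadj = λ x∈ y∈ → n≤0⇒n≡0 (≤-trans (Σ-∈ (adj G _) y∈) (deg≤ x∈)) }
  sameTrace T (suc D) (i ∷ I) X deg≤ T≤ with splitBy (λ x → adj G x i ≟ 0) X
  ... | X₀ , X₁ , p , zero₀ , pos₁ with T * subsets (length I) (suc D) ≤? length X₀
  ... | yes T≤₀ = record
    { I′ = i ∷ I′ ; J = J ; Z = Z ; W = W ++ X₁ ; I↭ = ↭-prep i I↭ ; |J|≤ = |J|≤
    ; X↭ = ↭-trans p (↭-++-assoc Z X↭)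
    ; T≤|Z| = T≤|Z|
    ; nonadj = λ { x∈ (here refl) → zero₀ (∈-left X↭ x∈) ; x∈ (there y∈) → nonadj x∈ y∈ } }
    where
    open SameTrace (sameTrace T (suc D) I X₀
      (λ x∈ → ≤-trans (m≤n+m _ _) (deg≤ (∈-left p x∈))) T≤₀)
  ... | no T≰₀ = record
    { I′ = I′ ; J = i ∷ J ; Z = Z ; W = W ++ X₀ ; I↭ = ↭-trans (↭-prep i I↭) (↭-sym (shift i I′ J)) ; |J|≤ = s≤s |J|≤
    ; X↭ = ↭-trans p (↭-trans (++-comm X₀ X₁) (↭-++-assoc Z X↭))
    ; T≤|Z| = T≤|Z| ; nonadj = nonadj }
    where
    -- If `X₀` falls short of the first summand of Pascal's recursion, `X₁` reaches the second.
    T≤₁ : T * subsets (length I) D ≤ length X₁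
    T≤₁ = +-cancelˡ-≤ (length X₀) _ _ (begin
      length X₀ + T * subsets (length I) D
        ≤⟨ +-monoˡ-≤ _ (≰⇒≥ T≰₀) ⟩
      T * subsets (length I) (suc D) + T * subsets (length I) D
        ≡⟨ *-distribˡ-+ T _ (subsets (length I) D) ⟨
      T * subsets (suc (length I)) (suc D) ≤⟨ T≤ ⟩
      length X                             ≡⟨ length-↭-++ X₀ X₁ p ⟩
      length X₀ + length X₁                ∎)
      where open ≤-Reasoning
    open SameTrace (sameTrace T D I X₁
      (λ x∈ → s≤s⁻¹ (≤-trans (+-monoˡ-≤ _ (n≢0⇒n>0 (pos₁ x∈)))
        (deg≤ (∈-right X₀ p x∈)))) T≤₁)

  module _ (ℓ : ℕ) where

    record Extraction (R : List V) : Set where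
      field
        {I Q}    : List V
        R↭       : R ↭ I ++ Q
        levelled : Levelled G ℓ I

    open Extraction

    -- The exchange step: at most `D` vertices leave and `ℓ` enter. The newcomers have no neighbour
    -- in `I′`, so the height stays at most `ℓ`.
    augment : ∀ {D R} → D < ℓ → (x : Extraction R) → ∀ {X Z} → Q x ↭ X ++ Z →
              SameTrace (2 ^ ℓ) D (I x) X → Σ (Extraction R) λ y → length (I x) < length (I y)
    augment {D} {R} D<ℓ x {X} {Z} Q↭ tr with transitive G ℓ (SameTrace.Z tr) (SameTrace.T≤|Z| tr)
    ... | Y , U , Z↭ , |Y| , L = record { R↭ = R↭′ ; levelled = levelled′ } , longer
      where
      open SameTrace tr using (I′; J; W; I↭; |J|≤; X↭; nonadj) renaming (Z to C)
      open ≤-Reasoning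
      rest : List V
      rest = J ++ (U ++ (W ++ Z))
      Q↭′ : Q x ↭ Y ++ (U ++ (W ++ Z))
      Q↭′ = ↭-trans Q↭ (↭-trans (↭-++-assoc C X↭) (↭-++-assoc Y Z↭))
      R↭′ : R ↭ (I′ ++ Y) ++ rest
      R↭′ = ↭-trans (R↭ x) (↭-trans (++⁺ I↭ Q↭′) (interchange I′ J Y (U ++ (W ++ Z))))
        where
        interchange : ∀ (a b c d : List V) → (a ++ b) ++ (c ++ d) ↭ (a ++ c) ++ (b ++ d)
        interchange a b c d = ↭-trans (↭-reflexive (++-assoc a b (c ++ d)))
          (↭-trans (++⁺ˡ a (↭-trans (↭-reflexive (sym (++-assoc b c d)))
            (↭-trans (++⁺ʳ d (++-comm b c)) (↭-reflexive (++-assoc c b d)))))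
          (↭-reflexive (sym (++-assoc a c (b ++ d)))))
      levelled′ : Levelled G ℓ (I′ ++ Y)
      levelled′ = levelled-++ G
        (levelled-⊆ G (λ y∈ → ∈-left I↭ y∈) (levelled x)) L
        (λ y∈ → nonadj (∈-left Z↭ y∈))
      longer : length (I x) < length (I′ ++ Y)
      longer = begin-strict
        length (I x)         ≡⟨ length-↭-++ I′ J I↭ ⟩
        length I′ + length J <⟨ +-monoʳ-< (length I′) (≤-<-trans |J|≤ D<ℓ) ⟩
        length I′ + ℓ        ≡⟨ cong (length I′ +_) |Y| ⟨
        length I′ + length Y ≡⟨ length-↭-++ I′ Y ↭-refl ⟨
        length (I′ ++ Y)     ∎

    -- Either the target size `S` is reached, or growth has stopped. In the latter case `z` counts
    -- the remaining vertices with more than `D` neighbours in `I`, and too few others are left for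
    -- an exchange.
    Grown : (D S : ℕ) {R : List V} → Extraction R → Set
    Grown D S x = S ≤ length (I x) ⊎ length (I x) < S × ∃ λ z →
      length (Q x) ≤ 2 ^ ℓ * subsets S D + z × z * suc D ≤ Σ[ Q x ] deg G (I x)

    grow : ∀ D S {R} → D < ℓ → Σ (Extraction R) (Grown D S)
    grow D S {R} D<ℓ = go S start (m≤n+m S 0)
      where
      start : Extraction R
      start = record { I = [] ; Q = R ; R↭ = ↭-refl
                     ; levelled = record { lev = λ _ → 0 ; lev< = λ () ; rise = λ () } }
      -- Every exchange lengthens `I`, so `S` rounds suffice, and spent fuel means that `S` is
      -- reached.
      go : ∀ fuel (x : Extraction R) → S ≤ length (I x) + fuel → Σ (Extraction R) (Grown D S)
      go zero x S≤ = x , inj₁ (≤-trans S≤ (≤-reflexive (+-identityʳ _)))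
      go (suc fuel) x S≤ with S ≤? length (I x) | splitBy (λ v → deg G (I x) v ≤? D) (Q x)
      ... | yes S≤′ | _ = x , inj₁ S≤′
      ... | no S≰   | X , Z , p , low , high with 2 ^ ℓ * subsets (length (I x)) D ≤? length X
      ...   | yes many = let y , longer = augment D<ℓ x p (sameTrace (2 ^ ℓ) D (I x) X low many) in
        go fuel y (≤-trans S≤ (≤-trans (≤-reflexive (+-suc _ fuel)) (+-monoˡ-≤ fuel longer)))
      ...   | no few = x , inj₂ (≰⇒> S≰ , length Z , |Q|≤ , edges)
        where
        open ≤-Reasoning
        |Q|≤ : length (Q x) ≤ 2 ^ ℓ * subsets S D + length Z
        |Q|≤ = begin
          length (Q x)        ≡⟨ length-↭-++ X Z p ⟩
          length X + length Z ≤⟨ +-monoˡ-≤ (length Z) (≰⇒≥ few) ⟩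
          2 ^ ℓ * subsets (length (I x)) D + length Z
            ≤⟨ +-monoˡ-≤ (length Z) (*-monoʳ-≤ (2 ^ ℓ) (subsets-mono D (≰⇒≥ S≰))) ⟩
          2 ^ ℓ * subsets S D + length Z ∎
        edges : length Z * suc D ≤ Σ[ Q x ] deg G (I x)
        edges = begin
          length Z * suc D                            ≤⟨ Σ-const-≤ (suc D) (deg G (I x)) Z (λ v∈ → ≰⇒> (high v∈)) ⟩
          Σ[ Z ] deg G (I x)                          ≤⟨ m≤n+m _ (Σ[ X ] deg G (I x)) ⟩
          (Σ[ X ] deg G (I x)) + (Σ[ Z ] deg G (I x)) ≡⟨ Σ-++ (deg G (I x)) X Z ⟨
          Σ[ X ++ Z ] deg G (I x)                     ≡⟨ Σ-↭ (deg G (I x)) p ⟨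
          Σ[ Q x ] deg G (I x)                        ∎

-- With u = ℓ r / P and a u ≤ 1 this reads (a + 1) u (1 - u) ≤ 1.
shrink : ∀ {a ℓ r r′ s P} → 1 ≤ r → 1 ≤ P → r ≡ s + r′ → r * r * ℓ ≤ s * P → a * ℓ * r ≤ P →
         suc a * ℓ * r′ ≤ P
shrink {a} {ℓ} {r} {r′} {s} {P} 1≤r 1≤P r≡ rrℓ≤ aℓr≤ = *-cancelʳ-≤ _ _ P {{>-nonZero 1≤P}} (begin
  suc a * ℓ * r′ * P      ≡⟨ assoc₁ (suc a) ℓ r′ P ⟩
  suc a * ℓ * (r′ * P)    ≤⟨ *-monoʳ-≤ (suc a * ℓ) r′P≤ ⟩
  suc a * ℓ * (r * w)     ≡⟨ expand a ℓ r w ⟩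
  (a * ℓ * r + y) * w     ≤⟨ *-monoˡ-≤ w (+-monoˡ-≤ y aℓr≤) ⟩
  (P + y) * w             ≡⟨ cong (λ p → (p + y) * w) P≡ ⟩
  -- Since `w` is P - y, this is (P + y) (P - y) ≤ P².
  (y + w + y) * w         ≤⟨ m≤m+n _ (y * y) ⟩
  (y + w + y) * w + y * y ≡⟨ square y w ⟩
  (y + w) * (y + w)       ≡⟨ cong₂ _*_ P≡ P≡ ⟨
  P * P                   ∎)
  where
  open ≤-Reasoning
  y w : ℕ
  y = r * ℓ
  w = P ∸ y
  assoc₁ : ∀ a b c d → a * b * c * d ≡ a * b * (c * d)
  assoc₁ = solve-∀
  expand : ∀ a ℓ r w → suc a * ℓ * (r * w) ≡ (a * ℓ * r + r * ℓ) * w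
  expand = solve-∀
  square : ∀ y w → (y + w + y) * w + y * y ≡ (y + w) * (y + w)
  square = solve-∀
  ry≤ : r * y ≤ s * P
  ry≤ = ≤-trans (≤-reflexive (sym (*-assoc r r ℓ))) rrℓ≤
  rP : r * P ≡ s * P + r′ * P
  rP = trans (cong (_* P) r≡) (*-distribʳ-+ P s r′)
  y≤P : y ≤ P
  y≤P = *-cancelˡ-≤ r {{>-nonZero 1≤r}} (≤-trans ry≤ (≤-trans (m≤m+n (s * P) _) (≤-reflexive (sym rP))))
  P≡ : P ≡ y + w
  P≡ = sym (m+[n∸m]≡n y≤P)
  r′P≤ : r′ * P ≤ r * w
  r′P≤ = +-cancelˡ-≤ (r * y) _ _ (begin
    r * y + r′ * P ≤⟨ +-monoˡ-≤ (r′ * P) ry≤ ⟩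
    s * P + r′ * P ≡⟨ rP ⟨
    r * P          ≡⟨ cong (r *_) P≡ ⟩
    r * (y + w)    ≡⟨ *-distribˡ-+ r y w ⟩
    r * y + r * w  ∎)

-- Needed because a degree of about ℓ / (3 + 2 t) has to be made up for by the factor `2 ^ t` in the
-- number of vertices.
3+2t≤2^[2+t] : ∀ t → 3 + 2 * t ≤ 2 ^ (2 + t)
3+2t≤2^[2+t] t = begin
  3 + 2 * t               ≤⟨ m≤m+n _ (1 + 2 * t) ⟩
  3 + 2 * t + (1 + 2 * t) ≡⟨ four t ⟩
  4 * suc t               ≤⟨ *-monoʳ-≤ 4 (n<2^n t) ⟩
  4 * 2 ^ t               ≡⟨ *-assoc 2 2 (2 ^ t) ⟩
  2 ^ (2 + t)             ∎
  where
  open ≤-Reasoning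
  four : ∀ t → 3 + 2 * t + (1 + 2 * t) ≡ 4 * suc t
  four = solve-∀

-- Covering a graph with at most N² edges by few classes

module _ (G : OrientedGraph) (ℓ : ℕ) (1≤ℓ : 1 ≤ ℓ) where

  open Extraction {G} {ℓ}

  -- With r the length of `R`: either `I` has at least ℓ (r / N)² vertices, or taking it out
  -- destroys at least ℓ N / 8 edges.
  Progress : ℕ → ∀ {R} → Extraction G ℓ R → Set
  Progress N {R} x =
    length R * length R * ℓ ≤ length (I x) * (N * N) ⊎ ℓ * N ≤ 8 * (Σ[ Q x ] deg G (I x))

  -- Here `2 ^ t` is r / N up to a factor of two, and the target `S` is at least ℓ (r / N)². If `I`
  -- falls short of `S`, at least r / 2 vertices have at least ℓ / d neighbours in `I` each. As r ≥
  -- 2^t N and d ≤ 4 · 2^t, these account for ℓ N / 8 edges.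
  extract : ∀ N R → 4 * (2 ^ ℓ * (2 ^ ℓ * 2 ^ ℓ)) ≤ N → N ≤ length R → length R ≤ ℓ * N →
            Σ (Extraction G ℓ R) (Progress N)
  extract N R 4A≤N N≤r r≤ℓN with bracket 2 N (length R) ℓ N≤r
    (≤-<-trans r≤ℓN (*-monoˡ-< N {{N≢0}} (n<2^n ℓ)))
    where
    N≢0 : NonZero N
    N≢0 = >-nonZero (≤-trans (≤-trans (s≤s z≤n) (*-monoʳ-≤ 4 (*-mono-≤ (m^n>0 2 ℓ) (*-mono-≤ (m^n>0 2 ℓ) (m^n>0 2 ℓ))))) 4A≤N)
  ... | t , t<ℓ , lo , hi = analyse (grow G ℓ D S D<ℓ)
    where
    open ≤-Reasoning
    A d D h S r : ℕ
    A = 2 ^ ℓ * (2 ^ ℓ * 2 ^ ℓ)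
    -- This choice gives 2^d = 2h, as `subsets-bound` asks. Dividing `pred ℓ` keeps `D` below `ℓ`,
    -- as the exchange requires, while `suc D * d` still reaches `ℓ`.
    d = 3 + 2 * t
    D = pred ℓ / d
    h = 2 ^ suc t * 2 ^ suc t
    S = h * ℓ
    r = length R
    ℓ≡ : suc (pred ℓ) ≡ ℓ
    ℓ≡ = suc-pred ℓ {{>-nonZero 1≤ℓ}}
    Dd≤ : D * d ≤ pred ℓ
    Dd≤ = m/n*n≤m (pred ℓ) d
    D<ℓ : D < ℓ
    D<ℓ = begin-strict
      D            ≤⟨ m≤m*n D d ⟩
      D * d        ≤⟨ Dd≤ ⟩
      pred ℓ       <⟨ n<1+n _ ⟩
      suc (pred ℓ) ≡⟨ ℓ≡ ⟩
      ℓ            ∎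
    ℓ≤ : ℓ ≤ suc D * d
    ℓ≤ = begin
      ℓ                        ≡⟨ ℓ≡ ⟨
      suc (pred ℓ)             ≡⟨ cong suc (m≡m%n+[m/n]*n (pred ℓ) d) ⟩
      suc (pred ℓ % d) + D * d ≤⟨ +-monoˡ-≤ (D * d) (m%n<n (pred ℓ) d) ⟩
      d + D * d                ∎
    2^d≡ : 2 ^ d ≡ h + h
    2^d≡ = trans (cong (2 ^_) (odd t)) (trans (cong (2 *_) (^-distribˡ-+-* 2 (suc t) (suc t))) (cong (h +_) (+-identityʳ h)))
      where
      odd : ∀ t → 3 + 2 * t ≡ suc (suc t + suc t)
      odd = solve-∀
    2≤2^ : 2 ≤ 2 ^ suc t
    2≤2^ = *-monoʳ-≤ 2 (m^n>0 2 t)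
    thr≤A : 2 ^ ℓ * subsets S D ≤ A
    thr≤A = *-monoʳ-≤ (2 ^ ℓ) (subsets-bound ℓ h d D (≤-trans (s≤s (s≤s z≤n)) (*-mono-≤ 2≤2^ 2≤2^)) 2^d≡
      (≤-trans Dd≤ (pred[n]≤n {ℓ})))
    S≤A : S ≤ A
    S≤A = begin
      2 ^ suc t * 2 ^ suc t * ℓ ≤⟨ *-mono-≤ (*-mono-≤ 2^t≤ 2^t≤) (<⇒≤ (n<2^n ℓ)) ⟩
      2 ^ ℓ * 2 ^ ℓ * 2 ^ ℓ     ≡⟨ *-assoc (2 ^ ℓ) _ _ ⟩
      A                         ∎
      where
      2^t≤ : 2 ^ suc t ≤ 2 ^ ℓ
      2^t≤ = ^-monoʳ-≤ 2 t<ℓ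
    analyse : Σ (Extraction G ℓ R) (Grown G ℓ D S) → Σ (Extraction G ℓ R) (Progress N)
    analyse (x , inj₁ S≤) = x , inj₁ (begin
      r * r * ℓ                           ≤⟨ *-monoˡ-≤ ℓ (*-mono-≤ (<⇒≤ hi) (<⇒≤ hi)) ⟩
      2 ^ suc t * N * (2 ^ suc t * N) * ℓ ≡⟨ regroup (2 ^ suc t) N ℓ ⟩
      S * (N * N)                         ≤⟨ *-monoˡ-≤ (N * N) S≤ ⟩
      length (I x) * (N * N)              ∎)
      where
      regroup : ∀ p n ℓ → p * n * (p * n) * ℓ ≡ p * p * ℓ * (n * n)
      regroup = solve-∀
    analyse (x , inj₂ (I<S , z , Q≤ , z≤)) = x , inj₂ (begin
      ℓ * N                      ≤⟨ *-monoˡ-≤ N ℓ≤ ⟩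
      suc D * d * N              ≤⟨ *-monoˡ-≤ N (*-monoʳ-≤ (suc D) (3+2t≤2^[2+t] t)) ⟩
      suc D * 2 ^ (2 + t) * N    ≡⟨ regroup (suc D) (2 ^ t) N ⟩
      4 * (2 ^ t * N * suc D)    ≤⟨ *-monoʳ-≤ 4 (*-monoˡ-≤ (suc D) (≤-trans lo r≤2z)) ⟩
      4 * (2 * z * suc D)        ≡⟨ regroup′ z (suc D) ⟩
      8 * (z * suc D)            ≤⟨ *-monoʳ-≤ 8 z≤ ⟩
      8 * (Σ[ Q x ] deg G (I x)) ∎)
      where
      regroup : ∀ D p n → D * (2 * (2 * p)) * n ≡ 4 * (p * n * D)
      regroup = solve-∀
      regroup′ : ∀ z D → 4 * (2 * z * D) ≡ 8 * (z * D)
      regroup′ = solve-∀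
      four : ∀ A z → 2 * (A + (A + z)) ≡ 4 * A + 2 * z
      four = solve-∀
      -- `I` and the vertices of low degree number at most `A` each, together at most r / 2 because
      -- 4A ≤ N ≤ r.
      r≤2z : r ≤ 2 * z
      r≤2z = +-cancelˡ-≤ r _ _ (begin
        r + r ≡⟨ cong (r +_) (+-identityʳ r) ⟨
        2 * r ≡⟨ cong (2 *_) (length-↭-++ (I x) (Q x) (R↭ x)) ⟩
        2 * (length (I x) + length (Q x))
          ≤⟨ *-monoʳ-≤ 2 (+-mono-≤ (≤-trans (<⇒≤ I<S) S≤A) (≤-trans Q≤ (+-monoˡ-≤ z thr≤A))) ⟩
        2 * (A + (A + z)) ≡⟨ four A z ⟩
        4 * A + 2 * z     ≤⟨ +-monoˡ-≤ (2 * z) (≤-trans 4A≤N N≤r) ⟩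
        r + 2 * z         ∎)

  singletons : ∀ R → Layered G ℓ (length R) R
  singletons []      = layered-[] G
  singletons (v ∷ R) = addClass G (v ∷ []) R ↭-refl
    (independent⇒levelled G 1≤ℓ λ { (here refl) (here refl) → adj-self G v }) (singletons R)

  -- Acyclic sets of exactly `ℓ` vertices are removed while `2 ^ ℓ` vertices remain. The leftover
  -- singletons account for the second summand.
  transitiveClasses : ∀ R → ∃ λ M → Layered G ℓ M R × ℓ * M ≤ length R + ℓ * 2 ^ ℓ
  transitiveClasses R = go (length R) R ≤-refl
    where
    open ≤-Reasoning
    go : ∀ fuel R → length R ≤ fuel → ∃ λ M → Layered G ℓ M R × ℓ * M ≤ length R + ℓ * 2 ^ ℓ
    go fuel R R≤ with 2 ^ ℓ ≤? length R
    ... | no 2^≰ = length R , singletons R , ≤-trans (*-monoʳ-≤ ℓ (≰⇒≥ 2^≰)) (m≤n+m _ (length R))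
    go zero       R R≤ | yes 2^≤ = ⊥-elim (<-irrefl refl (≤-trans (m^n>0 2 ℓ) (≤-trans 2^≤ R≤)))
    go (suc fuel) R R≤ | yes 2^≤ with transitive G ℓ R 2^≤
    ... | Y , W , p , |Y| , L with go fuel W (s≤s⁻¹ (begin
          suc (length W)      ≤⟨ +-monoˡ-≤ (length W) (≤-trans 1≤ℓ (≤-reflexive (sym |Y|))) ⟩
          length Y + length W ≡⟨ length-↭-++ Y W p ⟨
          length R            ≤⟨ R≤ ⟩
          suc fuel            ∎))
    ...   | M , K , M≤ = suc M , addClass G Y W p L K , (begin
          ℓ * suc M                       ≡⟨ *-suc ℓ M ⟩
          ℓ + ℓ * M                       ≤⟨ +-monoʳ-≤ ℓ M≤ ⟩
          ℓ + (length W + ℓ * 2 ^ ℓ)      ≡⟨ +-assoc ℓ _ _ ⟨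
          ℓ + length W + ℓ * 2 ^ ℓ        ≡⟨ cong (λ m → m + length W + ℓ * 2 ^ ℓ) |Y| ⟨
          length Y + length W + ℓ * 2 ^ ℓ ≡⟨ cong (_+ ℓ * 2 ^ ℓ) (length-↭-++ Y W p) ⟨
          length R + ℓ * 2 ^ ℓ            ∎)

  -- Each of the `i` removals destroys at least one edge per vertex of `R′`. The layering of `R′` is
  -- a parameter of the result because it is found only later.
  independentClasses : ∀ i R → ∃ λ R′ →
    (∀ {M} → Layered G ℓ M R′ → Layered G ℓ (i + M) R) × length R′ ≤ length R × i * length R′ + arcs G R′ R′ ≤ arcs G R R
  independentClasses zero    R = R , (λ K → K) , ≤-refl , ≤-refl
  independentClasses (suc i) R with maximalIndependent G R
  ... | I , Q , p , ind , dom with independentClasses i Q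
  ...   | R′ , lift , R′≤ , edges = R′ , (λ K → addClass G I Q p (independent⇒levelled G 1≤ℓ ind) (lift K)) ,
    ≤-trans R′≤ Q≤R , (begin
      length R′ + i * length R′ + arcs G R′ R′   ≡⟨ +-assoc (length R′) _ _ ⟩
      length R′ + (i * length R′ + arcs G R′ R′) ≤⟨ +-mono-≤ (≤-trans R′≤ Q≤deg) edges ⟩
      (Σ[ Q ] deg G I) + arcs G Q Q              ≡⟨ +-comm (Σ[ Q ] deg G I) _ ⟩
      arcs G Q Q + (Σ[ Q ] deg G I)              ≤⟨ arcs-split G I Q p ⟩
      arcs G R R                                 ∎)
    where
    open ≤-Reasoning
    Q≤R : length Q ≤ length R
    Q≤R = ≤-trans (m≤n+m _ (length I)) (≤-reflexive (sym (length-↭-++ I Q p)))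
    Q≤deg : length Q ≤ Σ[ Q ] deg G I
    Q≤deg = ≤-trans (≤-reflexive (sym (*-identityʳ _))) (Σ-const-≤ 1 (deg G I) Q dom)

  module _ (N : ℕ) (4A≤N : 4 * (2 ^ ℓ * (2 ^ ℓ * 2 ^ ℓ)) ≤ N) where

    private
      open ≤-Reasoning
      2^3ℓ≤N : 2 ^ ℓ * (2 ^ ℓ * 2 ^ ℓ) ≤ N
      2^3ℓ≤N = ≤-trans (m≤n*m _ 4) 4A≤N
      ℓ2^ℓ≤N : ℓ * 2 ^ ℓ ≤ N
      ℓ2^ℓ≤N = ≤-trans (*-mono-≤ (<⇒≤ (n<2^n ℓ)) (m≤n*m (2 ^ ℓ) (2 ^ ℓ) {{m^n≢0 2 ℓ}})) 2^3ℓ≤N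
      ℓ≤N : ℓ ≤ N
      ℓ≤N = ≤-trans (m≤m*n ℓ (2 ^ ℓ) {{m^n≢0 2 ℓ}}) ℓ2^ℓ≤N
      1≤N : 1 ≤ N
      1≤N = ≤-trans 1≤ℓ ℓ≤N

    -- An amortised count in which every class costs ℓ N. The cost is met by eight times the edges
    -- destroyed or by an increase of `a`; the term 4 N² covers the final value of `a` and the last
    -- classes.
    FewClasses : ℕ → List (Fin (order G)) → Set
    FewClasses a R = ∃ λ M → Layered G ℓ M R × ℓ * M * N + a * ℓ * N ≤ 8 * arcs G R R + 4 * (N * N)

    -- a counts the large classes extracted so far.
    sparseClasses : ∀ a R → length R ≤ ℓ * N → a * ℓ * length R ≤ N * N → a * ℓ * N ≤ 2 * (N * N) → FewClasses a R
    sparseClasses a R = go (length R) a R ≤-refl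
      where
      -- While r ≥ N, the bound a ℓ r ≤ N² kept up by `shrink` gives a ℓ ≤ N. The extraction that
      -- takes r below N may still add one to `a`, hence the separate bound with the factor 2.
      go : ∀ fuel a R → length R ≤ fuel → length R ≤ ℓ * N →
           a * ℓ * length R ≤ N * N → a * ℓ * N ≤ 2 * (N * N) → FewClasses a R
      step : ∀ fuel a R → length R ≤ suc fuel → length R ≤ ℓ * N →
            a * ℓ * length R ≤ N * N → N ≤ length R →
             (x : Extraction G ℓ R) → Progress N x → FewClasses a R
      go fuel a R R≤ R≤ℓN aR≤ aN≤ with N ≤? length R
      ... | no N≰ with transitiveClasses R
      ...   | M , K , M≤ = M , K , (begin
        -- The last vertices take ℓ M ≤ N + ℓ 2^ℓ ≤ 2 N, and `a` takes the other half of 4 N².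
        ℓ * M * N + a * ℓ * N        ≤⟨ +-mono-≤ (*-monoˡ-≤ N (≤-trans M≤ (+-mono-≤ (≰⇒≥ N≰) ℓ2^ℓ≤N))) aN≤ ⟩
        (N + N) * N + 2 * (N * N)    ≡⟨ four N ⟩
        4 * (N * N)                  ≤⟨ m≤n+m _ (8 * arcs G R R) ⟩
        8 * arcs G R R + 4 * (N * N) ∎)
        where
        four : ∀ N → (N + N) * N + 2 * (N * N) ≡ 4 * (N * N)
        four = solve-∀
      go zero       a R R≤ R≤ℓN aR≤ aN≤ | yes N≤ = ⊥-elim (<-irrefl refl (≤-trans 1≤N (≤-trans N≤ R≤)))
      go (suc fuel) a R R≤ R≤ℓN aR≤ aN≤ | yes N≤ with extract N R 4A≤N N≤ R≤ℓN
      ... | x , result = step fuel a R R≤ R≤ℓN aR≤ N≤ x result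
      step fuel a R R≤ R≤ℓN aR≤ N≤ x result = finish result
        where
        r≡ : length R ≡ length (I x) + length (Q x)
        r≡ = length-↭-++ (I x) (Q x) (R↭ x)
        Q≤R : length (Q x) ≤ length R
        Q≤R = ≤-trans (m≤n+m _ (length (I x))) (≤-reflexive (sym r≡))
        -- An empty `I` makes neither kind of progress. Hence the remaining list gets shorter, and
        -- the fuel lasts.
        nonempty : Progress N x → 1 ≤ length (I x)
        nonempty result with I x
        ... | _ ∷ _ = s≤s z≤n
        nonempty (inj₁ large) | [] =
          ≤-trans (*-mono-≤ (*-mono-≤ (≤-trans 1≤N N≤) (≤-trans 1≤N N≤)) 1≤ℓ) large
        nonempty (inj₂ many)  | [] =
          ⊥-elim (<-irrefl refl (≤-trans (*-mono-≤ 1≤ℓ 1≤N) (≤-trans many (≤-reflexive (cong (8 *_) (Σ-zero (Q x)))))))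
        Q≤fuel : length (Q x) ≤ fuel
        Q≤fuel = s≤s⁻¹ (≤-trans (+-monoˡ-≤ (length (Q x)) (nonempty result)) (≤-trans (≤-reflexive (sym r≡)) R≤))
        aN≤N : a * ℓ * N ≤ N * N
        aN≤N = ≤-trans (*-monoʳ-≤ (a * ℓ) N≤) aR≤
        edges : arcs G (Q x) (Q x) + (Σ[ Q x ] deg G (I x)) ≤ arcs G R R
        edges = arcs-split G (I x) (Q x) (R↭ x)
        finish : Progress N x → FewClasses a R
        finish (inj₁ large) with go fuel (suc a) (Q x) Q≤fuel (≤-trans Q≤R R≤ℓN)
          (shrink {a} (≤-trans 1≤N N≤) (*-mono-≤ 1≤N 1≤N) r≡ large aR≤)
          (begin
            suc a * ℓ * N       ≡⟨ *-assoc (suc a) ℓ N ⟩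
            ℓ * N + a * (ℓ * N) ≡⟨ cong (ℓ * N +_) (*-assoc a ℓ N) ⟨
            ℓ * N + a * ℓ * N   ≤⟨ +-mono-≤ (*-monoˡ-≤ N ℓ≤N) aN≤N ⟩
            N * N + N * N       ≡⟨ cong (N * N +_) (+-identityʳ _) ⟨
            2 * (N * N)         ∎)
        ... | M , K , M≤ = suc M , addClass G (I x) (Q x) (R↭ x) (levelled x) K , (begin
            ℓ * suc M * N + a * ℓ * N            ≡⟨ move ℓ M N a ⟩
            ℓ * M * N + suc a * ℓ * N            ≤⟨ M≤ ⟩
            8 * arcs G (Q x) (Q x) + 4 * (N * N)
              ≤⟨ +-monoˡ-≤ (4 * (N * N)) (*-monoʳ-≤ 8 (≤-trans (m≤m+n (arcs G (Q x) (Q x)) _) edges)) ⟩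
            8 * arcs G R R + 4 * (N * N)         ∎)
          where
          move : ∀ ℓ M N a → ℓ * suc M * N + a * ℓ * N ≡ ℓ * M * N + suc a * ℓ * N
          move = solve-∀
        finish (inj₂ many) with go fuel a (Q x) Q≤fuel (≤-trans Q≤R R≤ℓN)
          (≤-trans (*-monoʳ-≤ (a * ℓ) Q≤R) aR≤) (≤-trans aN≤N (m≤n*m (N * N) 2))
        ... | M , K , M≤ = suc M , addClass G (I x) (Q x) (R↭ x) (levelled x) K , (begin
            ℓ * suc M * N + a * ℓ * N           ≡⟨ move ℓ M N a ⟩
            ℓ * N + (ℓ * M * N + a * ℓ * N)     ≤⟨ +-mono-≤ many M≤ ⟩
            8 * (Σ[ Q x ] deg G (I x)) + (8 * arcs G (Q x) (Q x) + 4 * (N * N))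
              ≡⟨ collect (Σ[ Q x ] deg G (I x)) (arcs G (Q x) (Q x)) (N * N) ⟩
            8 * (arcs G (Q x) (Q x) + (Σ[ Q x ] deg G (I x))) + 4 * (N * N)
              ≤⟨ +-monoˡ-≤ (4 * (N * N)) (*-monoʳ-≤ 8 edges) ⟩
            8 * arcs G R R + 4 * (N * N) ∎)
          where
          move : ∀ ℓ M N a → ℓ * suc M * N + a * ℓ * N ≡ ℓ * N + (ℓ * M * N + a * ℓ * N)
          move = solve-∀
          collect : ∀ a b c → 8 * a + (8 * b + 4 * c) ≡ 8 * (b + a) + 4 * c
          collect = solve-∀

    fewClasses : size G ≤ N * N → ∃ λ M → Layered G ℓ M (allFin (order G)) × ℓ * M ≤ 14 * N
    fewClasses size≤ with independentClasses (suc (N / ℓ)) (allFin (order G))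
      where instance ℓ≢0 = >-nonZero 1≤ℓ
    ... | R′ , lift , _ , edges = combine (sparseClasses 0 R′ R′≤ z≤n z≤n)
      where
      instance
        ℓ≢0 : NonZero ℓ
        ℓ≢0 = >-nonZero 1≤ℓ
        N≢0 : NonZero N
        N≢0 = >-nonZero 1≤N
      -- After so many independent classes at most N² / i ≤ ℓ N vertices remain, which is where
      -- `extract` can start; and ℓ i is still at most 2 N.
      i : ℕ
      i = suc (N / ℓ)
      edges′ : i * length R′ + arcs G R′ R′ ≤ N * N
      edges′ = ≤-trans edges (≤-trans (≤-reflexive (arcs-size G)) size≤)
      N≤ℓi : N ≤ ℓ * i
      N≤ℓi = begin
        N                 ≡⟨ m≡m%n+[m/n]*n N ℓ ⟩
        N % ℓ + N / ℓ * ℓ ≤⟨ +-monoˡ-≤ (N / ℓ * ℓ) (<⇒≤ (m%n<n N ℓ)) ⟩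
        i * ℓ             ≡⟨ *-comm i ℓ ⟩
        ℓ * i             ∎
      ℓi≤2N : ℓ * i ≤ 2 * N
      ℓi≤2N = begin
        ℓ * i         ≡⟨ *-comm ℓ i ⟩
        ℓ + N / ℓ * ℓ ≤⟨ +-mono-≤ ℓ≤N (m/n*n≤m N ℓ) ⟩
        N + N         ≡⟨ cong (N +_) (+-identityʳ N) ⟨
        2 * N         ∎
      R′≤ : length R′ ≤ ℓ * N
      R′≤ = *-cancelˡ-≤ N (begin
        N * length R′       ≤⟨ *-monoˡ-≤ (length R′) N≤ℓi ⟩
        ℓ * i * length R′   ≡⟨ *-assoc ℓ i _ ⟩
        ℓ * (i * length R′) ≤⟨ *-monoʳ-≤ ℓ (≤-trans (m≤m+n _ (arcs G R′ R′)) edges′) ⟩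
        ℓ * (N * N)         ≡⟨ swap ℓ N ⟩
        N * (ℓ * N)         ∎)
        where
        swap : ∀ ℓ N → ℓ * (N * N) ≡ N * (ℓ * N)
        swap = solve-∀
      combine : FewClasses 0 R′ → ∃ λ M → Layered G ℓ M (allFin (order G)) × ℓ * M ≤ 14 * N
      combine (M , K , M≤) = i + M , lift K , (begin
        ℓ * (i + M)    ≡⟨ *-distribˡ-+ ℓ i M ⟩
        ℓ * i + ℓ * M  ≤⟨ +-mono-≤ ℓi≤2N ℓM≤ ⟩
        2 * N + 12 * N ≡⟨ *-distribʳ-+ N 2 12 ⟨
        14 * N         ∎)
        where
        ℓM≤ : ℓ * M ≤ 12 * N
        ℓM≤ = *-cancelʳ-≤ _ _ N (begin
          ℓ * M * N                      ≡⟨ +-identityʳ _ ⟨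
          ℓ * M * N + 0                  ≤⟨ M≤ ⟩
          8 * arcs G R′ R′ + 4 * (N * N)
            ≤⟨ +-monoˡ-≤ (4 * (N * N)) (*-monoʳ-≤ 8 (≤-trans (m≤n+m _ (i * length R′)) edges′)) ⟩
          8 * (N * N) + 4 * (N * N)      ≡⟨ *-distribʳ-+ (N * N) 8 4 ⟨
          12 * (N * N)                   ≡⟨ *-assoc 12 N N ⟨
          12 * N * N                     ∎)

-- Potentials and colourings without long monochromatic paths

potential⇒¬Arrows : ∀ (G : OrientedGraph) q b n (φ : Fin q → Fin (order G) → ℕ) →
  (∀ i x → φ i x < b) → (∀ x y → G [ x ⟶ y ] → ∃ λ i → φ i x < φ i y) → b < n → ¬ Arrows G (path n) q
potential⇒¬Arrows G q b n φ φ<b rise b<n arrows with arrows (λ x y x⟶y → proj₁ (rise x y x⟶y))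
... | c , f , _ , mono = <-irrefl refl (≤-<-trans (climb b b<n) (φ<b c _))
  where
  -- An edge is coloured by a potential that it raises, so `φ c` grows at every step of a path of
  -- colour `c`. Counted from 0, vertex `b` of the path would have potential at least `b`.
  climb : ∀ j (j<n : j < n) → j ≤ φ c (f (fromℕ< j<n))
  climb zero    _   = z≤n
  climb (suc j) j<n = ≤-<-trans (climb j (<⇒≤ j<n)) up
    where
    edge : path n [ fromℕ< (<⇒≤ j<n) ⟶ fromℕ< j<n ]
    edge = ≡⇒≡ᵇ _ _ (trans (Fin.toℕ-fromℕ< j<n) (cong suc (sym (Fin.toℕ-fromℕ< (<⇒≤ j<n)))))
    up : φ c (f (fromℕ< (<⇒≤ j<n))) < φ c (f (fromℕ< j<n))
    up with mono _ _ edge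
    ... | e , χ≡c = subst (λ i → φ i (f (fromℕ< (<⇒≤ j<n))) < φ i (f (fromℕ< j<n))) χ≡c (proj₂ (rise _ _ e))

digit : (h : ℕ) .{{_ : NonZero h}} → ℕ → ℕ → ℕ
digit h zero    l = l % h
digit h (suc j) l = digit h j (l / h)

digit< : ∀ h .{{_ : NonZero h}} j l → digit h j l < h
digit< h zero    l = m%n<n l h
digit< h (suc j) l = digit< h j (l / h)

-- If the quotient by `h` does not rise, the last digit must; otherwise a digit of the quotient
-- rises.
digit-rise : ∀ h .{{_ : NonZero h}} k {l l′} → l < l′ → l′ < h ^ k → ∃ λ j → j < k × digit h j l < digit h j l′
digit-rise h zero    l<l′ l′< = ⊥-elim (n≮0 (<-≤-trans l<l′ (s≤s⁻¹ l′<)))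
digit-rise h (suc k) {l} {l′} l<l′ l′< with l / h <? l′ / h
... | yes l/h< with digit-rise h k l/h< (m<n*o⇒m/o<n (<-≤-trans l′< (≤-reflexive (*-comm h (h ^ k)))))
...   | j , j<k , d< = suc j , s≤s j<k , d<
digit-rise h (suc k) {l} {l′} l<l′ l′< | no l/h≮ = 0 , s≤s z≤n , +-cancelʳ-< (l / h * h) _ _ (begin-strict
  l % h + l / h * h   ≡⟨ m≡m%n+[m/n]*n l h ⟨
  l                   <⟨ l<l′ ⟩
  l′                  ≡⟨ m≡m%n+[m/n]*n l′ h ⟩
  l′ % h + l′ / h * h ≤⟨ +-monoʳ-≤ (l′ % h) (*-monoˡ-≤ h (≮⇒≥ l/h≮)) ⟩
  l′ % h + l / h * h  ∎)
  where open ≤-Reasoning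

∑< : ℕ → (ℕ → ℕ) → ℕ
∑< zero    f = 0
∑< (suc k) f = ∑< k f + f k

∑<-mono : ∀ k {f g} → (∀ {j} → j < k → f j ≤ g j) → ∑< k f ≤ ∑< k g
∑<-mono zero    f≤g = z≤n
∑<-mono (suc k) f≤g = +-mono-≤ (∑<-mono k (λ j<k → f≤g (m<n⇒m<1+n j<k))) (f≤g (n<1+n k))

∑<-strict : ∀ k {f g i} → (∀ {j} → j < k → f j ≤ g j) → i < k → f i < g i → ∑< k f < ∑< k g
∑<-strict (suc k) {i = i} f≤g i<1+k fi<gi with m≤n⇒m<n∨m≡n (s≤s⁻¹ i<1+k)
... | inj₁ i<k  = +-mono-<-≤ (∑<-strict k (λ j<k → f≤g (m<n⇒m<1+n j<k)) i<k fi<gi) (f≤g (n<1+n k))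
... | inj₂ refl = +-mono-≤-< (∑<-mono k (λ j<k → f≤g (m<n⇒m<1+n j<k))) fi<gi

∑<-bound : ∀ k {f} b → (∀ j → f j ≤ b) → ∑< k f ≤ k * b
∑<-bound zero    b f≤b = z≤n
∑<-bound (suc k) b f≤b = ≤-trans (+-mono-≤ (∑<-bound k b f≤b) (f≤b k)) (≤-reflexive (+-comm (k * b) b))

lex< : ∀ {a b l h} l′ → a < b → l < h → a * h + l < b * h + l′
lex< {a} {b} {l} {h} l′ a<b l<h = begin-strict
  a * h + l  <⟨ +-monoʳ-< (a * h) l<h ⟩
  a * h + h  ≡⟨ +-comm (a * h) h ⟩
  suc a * h  ≤⟨ *-monoˡ-≤ h a<b ⟩
  b * h      ≤⟨ m≤m+n _ l′ ⟩
  b * h + l′ ∎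
  where open ≤-Reasoning

-- Compare the class numbers at the ends of an edge. If they rise, so does a class digit. If they
-- agree, a level digit rises while the class parts of the potentials stay fixed. If they fall and
-- no class digit rises, the digit sum falls, which raises potential 0.
layered⇒¬Arrows : ∀ G ℓ M k m h n → 1 ≤ k → 1 ≤ m → 1 ≤ h → Layered G ℓ M (allFin (order G)) →
                  M ≤ m ^ k → ℓ ≤ h ^ suc k → k * m * h < n → ¬ Arrows G (path n) (suc k)
layered⇒¬Arrows G ℓ M k m h n 1≤k 1≤m 1≤h K M≤ ℓ≤ kmh<n =
  potential⇒¬Arrows G (suc k) (k * m * h) n (λ i → φ (toℕ i)) (λ i → φ< (toℕ i) (s≤s⁻¹ (Fin.toℕ<n i))) rise′ kmh<n
  where
  open Layered K
  instance
    m≢0 : NonZero m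
    m≢0 = >-nonZero 1≤m
    h≢0 : NonZero h
    h≢0 = >-nonZero 1≤h
  c l : ℕ → Fin (order G) → ℕ
  c j x = digit m j (cls x)
  l j x = digit h j (lev x)
  top : ℕ
  top = k * pred m
  C : Fin (order G) → ℕ
  C x = ∑< k (λ j → c j x)
  C≤ : ∀ x → C x ≤ top
  C≤ x = ∑<-bound k (pred m) (λ j → s≤s⁻¹ (≤-trans (digit< m j (cls x)) (≤-reflexive (sym (suc-pred m)))))
  φ : ℕ → Fin (order G) → ℕ
  φ zero    x = (top ∸ C x) * h + l 0 x
  φ (suc j) x = c j x * h + l (suc j) x
  top< : top < k * m
  top< = begin-strict
    k * pred m <⟨ *-monoʳ-< k {{>-nonZero 1≤k}} (≤-reflexive (suc-pred m)) ⟩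
    k * m      ∎
    where open ≤-Reasoning
  φ< : ∀ j → j ≤ k → ∀ x → φ j x < k * m * h
  φ< zero    _   x = <-≤-trans (lex< 0 (≤-<-trans (m∸n≤m top (C x)) top<) (digit< h 0 (lev x))) (≤-reflexive (+-identityʳ _))
  φ< (suc j) _   x = <-≤-trans (lex< 0 (<-≤-trans (digit< m j (cls x)) (m≤n*m m k {{>-nonZero 1≤k}})) (digit< h (suc j) (lev x)))
                       (≤-reflexive (+-identityʳ _))
  digits↑ : ∀ {x y j} → j < k → c j x < c j y → ∃ λ i → i < suc k × φ i x < φ i y
  digits↑ {x} {y} {j} j<k c< = suc j , s≤s j<k , lex< (l (suc j) y) c< (digit< h (suc j) (lev x))
  rise″ : ∀ {x y} → G [ x ⟶ y ] → ∃ λ i → i < suc k × φ i x < φ i y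
  rise″ {x} {y} x⟶y with <-cmp (cls x) (cls y)
  ... | tri< cls<′ _ _ with digit-rise m k cls<′ (<-≤-trans (cls< (∈-allFin y)) M≤)
  ...   | j , j<k , c< = digits↑ j<k c<
  rise″ {x} {y} x⟶y | tri≈ _ eq _
    with digit-rise h (suc k) (rise (∈-allFin x) (∈-allFin y) x⟶y eq) (<-≤-trans (lev< (∈-allFin y)) ℓ≤)
  ...   | zero  , j<k , l< = 0 , j<k , <-≤-trans (+-monoʳ-< ((top ∸ C x) * h) l<)
    (≤-reflexive (cong (λ u → (top ∸ ∑< k (λ j → digit m j u)) * h + l 0 y) eq))
  ...   | suc j , j<k , l< = suc j , j<k , <-≤-trans (+-monoʳ-< (c j x * h) l<)
    (≤-reflexive (cong (λ u → digit m j u * h + l (suc j) y) eq))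
  rise″ {x} {y} x⟶y | tri> _ _ cls>
    with anyUpTo? (λ j → c j x <? c j y) k
  ... | yes (j , j<k , c<) = digits↑ j<k c<
  ... | no none with digit-rise m k cls> (<-≤-trans (cls< (∈-allFin x)) M≤)
  ...   | j , j<k , c> = 0 , s≤s z≤n , lex< (l 0 y) (∸-monoʳ-< C< (C≤ x)) (digit< h 0 (lev x))
    where
    C< : C y < C x
    C< = ∑<-strict k (λ {i} i<k → ≮⇒≥ (λ c< → none (i , i<k , c<))) j<k c>
  rise′ : ∀ x y → G [ x ⟶ y ] → ∃ λ i → φ (toℕ i) x < φ (toℕ i) y
  rise′ x y x⟶y with rise″ x⟶y
  ... | i , i<1+k , φ↑ = fromℕ< i<1+k , subst (λ j → φ j x < φ j y) (sym (Fin.toℕ-fromℕ< i<1+k)) φ↑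

-- Choice of the parameters

ceilRoot : ∀ k ℓ → 1 ≤ ℓ → ∃ λ h → 1 ≤ h × h ≤ ℓ × ℓ ≤ h ^ suc k × h ^ suc k ≤ 2 ^ suc k * ℓ
ceilRoot k (suc zero) _ = 1 , ≤-refl , ≤-refl , ≤-reflexive (sym (^-zeroˡ (suc k))) ,
  (begin
    1 ^ suc k     ≤⟨ ^-monoˡ-≤ (suc k) (s≤s z≤n) ⟩
    2 ^ suc k     ≡⟨ *-identityʳ _ ⟨
    2 ^ suc k * 1 ∎)
  where open ≤-Reasoning
ceilRoot k (suc ℓ@(suc _)) _ with ceilRoot k ℓ (s≤s z≤n)
... | h , 1≤h , h≤ℓ , ℓ≤ , ≤2ℓ with suc ℓ ≤? h ^ suc k
... | yes ℓ<  = h , 1≤h , m≤n⇒m≤1+n h≤ℓ , ℓ< , ≤-trans ≤2ℓ (*-monoʳ-≤ (2 ^ suc k) (n≤1+n ℓ))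
-- The old root is too small by now. Its successor is at most 2h, which costs only the factor
-- `2 ^ suc k`.
... | no ℓ≮   = suc h , s≤s z≤n , s≤s h≤ℓ , ≤-<-trans ℓ≤ (^-monoˡ-< (suc k) (n<1+n h)) , (begin
    suc h ^ suc k         ≤⟨ ^-monoˡ-≤ (suc k) (+-mono-≤ 1≤h (≤-reflexive (sym (+-identityʳ h)))) ⟩
    (2 * h) ^ suc k       ≡⟨ ^-distribʳ-* 2 h (suc k) ⟩
    2 ^ suc k * h ^ suc k ≤⟨ *-monoʳ-≤ (2 ^ suc k) (≰⇒≥ ℓ≮) ⟩
    2 ^ suc k * suc ℓ     ∎)
  where open ≤-Reasoning

n≤n^suc : ∀ n k → n ≤ n ^ suc k
n≤n^suc zero    k = z≤n
n≤n^suc n@(suc _) k = m≤m*n n (n ^ k) {{m^n≢0 n k}}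

^2≡* : ∀ n → n ^ 2 ≡ n * n
^2≡* n = cong (n *_) (*-identityʳ n)

16^≡ : ∀ ℓ → 16 ^ ℓ ≡ 2 ^ ℓ * (2 ^ ℓ * (2 ^ ℓ * 2 ^ ℓ))
16^≡ ℓ = trans (^-distribʳ-* 2 8 ℓ) (cong (2 ^ ℓ *_) (trans (^-distribʳ-* 2 4 ℓ) (cong (2 ^ ℓ *_) (^-distribʳ-* 2 2 ℓ))))

-- Without edges even a constant potential rises along all of them, which excludes paths on two
-- vertices.
arrows⇒1≤size : ∀ {G n q} → 2 ≤ n → Arrows G (path n) (suc q) → 1 ≤ size G
arrows⇒1≤size {G} {n} {q} 2≤n arrows with 1 ≤? size G
... | yes 1≤ = 1≤
... | no 1≰  = ⊥-elim (potential⇒¬Arrows G (suc q) 1 n (λ _ _ → 0) (λ _ _ → s≤s z≤n) noEdge 2≤n arrows)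
  where
  noEdge : ∀ x y → G [ x ⟶ y ] → ∃ λ (i : Fin (suc q)) → 0 < 0
  noEdge x y x⟶y = ⊥-elim (E≡0⇒¬⟶ G (n≤0⇒n≡0 (begin
    E G x y                                      ≤⟨ Σ-∈ (E G x) (∈-allFin y) ⟩
    Σ[ allFin (order G) ] E G x                  ≤⟨ Σ-∈ (λ x → Σ[ allFin (order G) ] E G x) (∈-allFin x) ⟩
    arcs G (allFin (order G)) (allFin (order G)) ≡⟨ arcs-size G ⟩
    size G                                       ≤⟨ s≤s⁻¹ (≰⇒> 1≰) ⟩
    0                                            ∎)) x⟶y)
    where open ≤-Reasoning

module _ (w k ℓ n h : ℕ) (14≤w : 14 ≤ w) (1≤k : 1 ≤ k) (32wk≤2^ℓ : 32 * (w * k) ≤ 2 ^ ℓ) (16^ℓ≤n : 16 ^ ℓ ≤ n)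
         (1≤h : 1 ≤ h) (h≤ℓ : h ≤ ℓ) (ℓ≤h^ : ℓ ≤ h ^ suc k) (h^≤ : h ^ suc k ≤ 2 ^ suc k * ℓ) where

  private
    open ≤-Reasoning
    instance
      h≢0 : NonZero h
      h≢0 = >-nonZero 1≤h
      k≢0 : NonZero k
      k≢0 = >-nonZero 1≤k
      w≢0 : NonZero w
      w≢0 = >-nonZero (≤-trans (s≤s z≤n) 14≤w)
      wk≢0 : NonZero (w * k)
      wk≢0 = m*n≢0 w k
      A≢0 : NonZero (8 * (w * k))
      A≢0 = m*n≢0 8 (w * k)
    -- `w` dominates the factor 14 of `fewClasses`. The base `m` exceeds 4 w a / h, to make room for
    -- w N / ℓ classes, and `A` is chosen so that k m h is about n / 2.
    A a N m p : ℕ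
    A = 8 * (w * k)
    a = n / A
    N = a ^ k * h
    m = suc (4 * w * a / h)
    p = 2 ^ ℓ
    p⁴≤n : p * (p * (p * p)) ≤ n
    p⁴≤n = ≤-trans (≤-reflexive (sym (16^≡ ℓ))) 16^ℓ≤n
    -- `fewClasses` asks for p³ only; the fourth factor `p` in n ≥ 16^ℓ = p⁴ absorbs the division by
    -- `A`.
    4p³≤a : 4 * (p * (p * p)) ≤ a
    4p³≤a = begin
      4 * (p * (p * p))         ≡⟨ m*n/n≡m _ A ⟨
      4 * (p * (p * p)) * A / A ≤⟨ /-monoˡ-≤ A (begin
        4 * (p * (p * p)) * A        ≡⟨ regroup (w * k) (p * (p * p)) ⟩
        32 * (w * k) * (p * (p * p)) ≤⟨ *-monoˡ-≤ (p * (p * p)) 32wk≤2^ℓ ⟩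
        p * (p * (p * p))            ≤⟨ p⁴≤n ⟩
        n                            ∎) ⟩
      a ∎
      where
      regroup : ∀ k q → 4 * q * (8 * k) ≡ 32 * k * q
      regroup = solve-∀
    1≤a : 1 ≤ a
    1≤a = ≤-trans (*-mono-≤ (s≤s (z≤n {3})) (*-mono-≤ 1≤p (*-mono-≤ 1≤p 1≤p))) 4p³≤a
      where
      1≤p : 1 ≤ p
      1≤p = m^n>0 2 ℓ
    a≤N : a ≤ N
    a≤N = ≤-trans (≤-trans (n≤n^suc a (pred k)) (≤-reflexive (cong (a ^_) (suc-pred k)))) (m≤m*n (a ^ k) h)
    Aa≤n : a * A ≤ n
    Aa≤n = m/n*n≤m n A
    n≤2Aa : n ≤ 2 * A * a
    n≤2Aa = begin
      n             ≡⟨ m≡m%n+[m/n]*n n A ⟩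
      n % A + a * A ≤⟨ +-monoˡ-≤ (a * A) (≤-trans (<⇒≤ (m%n<n n A)) (m≤n*m A a {{>-nonZero 1≤a}})) ⟩
      a * A + a * A ≡⟨ twice a A ⟩
      2 * A * a     ∎
      where
      twice : ∀ a A → a * A + a * A ≡ 2 * A * a
      twice = solve-∀
    4wa≤mh : 4 * w * a ≤ m * h
    4wa≤mh = begin
      4 * w * a                         ≡⟨ m≡m%n+[m/n]*n (4 * w * a) h ⟩
      4 * w * a % h + 4 * w * a / h * h ≤⟨ +-monoˡ-≤ (4 * w * a / h * h) (<⇒≤ (m%n<n (4 * w * a) h)) ⟩
      m * h                             ∎
    kmh<n : k * m * h < n
    kmh<n = *-cancelˡ-< 2 _ _ (begin-strict
      2 * (k * m * h)         ≡⟨ regroup k m h ⟩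
      2 * k * (m * h)         ≤⟨ *-monoʳ-≤ (2 * k) (+-monoʳ-≤ h (m/n*n≤m (4 * w * a) h)) ⟩
      2 * k * (h + 4 * w * a) ≡⟨ expand w k h a ⟩
      2 * k * h + a * A       <⟨ +-mono-<-≤ 2kh<n Aa≤n ⟩
      n + n                   ≡⟨ cong (n +_) (+-identityʳ n) ⟨
      2 * n                   ∎)
      where
      regroup : ∀ k m h → 2 * (k * m * h) ≡ 2 * k * (m * h)
      regroup = solve-∀
      expand : ∀ w k h a → 2 * k * (h + 4 * w * a) ≡ 2 * k * h + a * (8 * (w * k))
      expand = solve-∀
      instance
        p≢0 : NonZero p
        p≢0 = m^n≢0 2 ℓ
      2kh<n : 2 * k * h < n
      2kh<n = begin-strict
        2 * k * h         ≤⟨ *-mono-≤ (≤-trans (*-mono-≤ (m≤m+n 2 30) (m≤n*m k w)) 32wk≤2^ℓ) h≤ℓ ⟩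
        p * ℓ             <⟨ *-monoʳ-< p (n<2^n ℓ) ⟩
        p * p             ≤⟨ *-monoʳ-≤ p (m≤m*n p (p * p) {{m*n≢0 p p}}) ⟩
        p * (p * (p * p)) ≤⟨ p⁴≤n ⟩
        n                 ∎
    -- M h^k ≤ w a^k h^(k+1) / ℓ ≤ 2 w 2^k a^k ≤ (4 w a)^k ≤ (m h)^k, where k ≥ 1 allows 2 w to be
    -- replaced by its `k`-th power.
    manyClasses : ∀ M → ℓ * M ≤ w * N → M ≤ m ^ k
    manyClasses M ℓM≤ = *-cancelʳ-≤ _ _ (h ^ k) {{m^n≢0 h k}} (begin
      M * h ^ k       ≤⟨ *-cancelˡ-≤ ℓ {{>-nonZero (≤-trans 1≤h h≤ℓ)}} scaled ⟩
      (4 * w * a) ^ k ≤⟨ ^-monoˡ-≤ k 4wa≤mh ⟩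
      (m * h) ^ k     ≡⟨ ^-distribʳ-* m h k ⟩
      m ^ k * h ^ k   ∎)
      where
      2w·2^k≤ : 2 * w * 2 ^ k ≤ (4 * w) ^ k
      2w·2^k≤ = begin
        2 * w * 2 ^ k
          ≤⟨ *-monoˡ-≤ (2 ^ k) (≤-trans (n≤n^suc (2 * w) (pred k)) (≤-reflexive (cong ((2 * w) ^_) (suc-pred k)))) ⟩
        (2 * w) ^ k * 2 ^ k ≡⟨ ^-distribʳ-* (2 * w) 2 k ⟨
        (2 * w * 2) ^ k     ≡⟨ cong (_^ k) (double w) ⟩
        (4 * w) ^ k         ∎
        where
        double : ∀ w → 2 * w * 2 ≡ 4 * w
        double = solve-∀
      regroup₁ : ∀ w b h q → w * (b * h) * q ≡ w * (b * (h * q))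
      regroup₁ = solve-∀
      regroup₂ : ∀ w b q ℓ → w * (b * (2 * q * ℓ)) ≡ ℓ * (2 * w * q * b)
      regroup₂ = solve-∀
      scaled : ℓ * (M * h ^ k) ≤ ℓ * (4 * w * a) ^ k
      scaled = begin
        ℓ * (M * h ^ k)               ≡⟨ *-assoc ℓ M _ ⟨
        ℓ * M * h ^ k                 ≤⟨ *-monoˡ-≤ (h ^ k) ℓM≤ ⟩
        w * N * h ^ k                 ≡⟨ regroup₁ w (a ^ k) h (h ^ k) ⟩
        w * (a ^ k * h ^ suc k)       ≤⟨ *-monoʳ-≤ w (*-monoʳ-≤ (a ^ k) h^≤) ⟩
        w * (a ^ k * (2 ^ suc k * ℓ)) ≡⟨ regroup₂ w (a ^ k) (2 ^ k) ℓ ⟩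
        ℓ * (2 * w * 2 ^ k * a ^ k)   ≤⟨ *-monoʳ-≤ ℓ (*-monoˡ-≤ (a ^ k) 2w·2^k≤) ⟩
        ℓ * ((4 * w) ^ k * a ^ k)     ≡⟨ cong (ℓ *_) (^-distribʳ-* (4 * w) a k) ⟨
        ℓ * (4 * w * a) ^ k           ∎

  arrows⇒N²≤size : ∀ G → Arrows G (path n) (suc k) → N * N ≤ size G
  arrows⇒N²≤size G arrows = ≮⇒≥ λ size< → refute (fewClasses G ℓ (≤-trans 1≤h h≤ℓ) N (≤-trans 4p³≤a a≤N) (<⇒≤ size<))
    where
    refute : ¬ (∃ λ M → Layered G ℓ M (allFin (order G)) × ℓ * M ≤ 14 * N)
    refute (M , K , ℓM≤) = layered⇒¬Arrows G ℓ M k m h n 1≤k (s≤s z≤n) 1≤h K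
      (manyClasses M (≤-trans ℓM≤ (*-monoˡ-≤ N 14≤w))) ℓ≤h^ kmh<n arrows

  -- Up to a constant, n^(2k) h² is N². The factor h² is what becomes the power of the logarithm, as
  -- h is about ℓ^(1/(k+1)).
  arrows⇒large : ∀ G → Arrows G (path n) (suc k) →
                 n ^ (2 * k) * (h * h) ≤ (2 * (8 * (w * k))) ^ (2 * k) * size G
  arrows⇒large G arrows = begin
    n ^ (2 * k) * (h * h)                         ≤⟨ *-monoˡ-≤ (h * h) (^-monoˡ-≤ (2 * k) n≤2Aa) ⟩
    (2 * A * a) ^ (2 * k) * (h * h)               ≡⟨ cong (_* (h * h)) (^-distribʳ-* (2 * A) a (2 * k)) ⟩
    (2 * A) ^ (2 * k) * a ^ (2 * k) * (h * h)     ≡⟨ cong (λ v → (2 * A) ^ (2 * k) * v * (h * h)) a^2k≡ ⟩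
    (2 * A) ^ (2 * k) * (a ^ k * a ^ k) * (h * h) ≡⟨ regroup ((2 * A) ^ (2 * k)) (a ^ k) h ⟩
    (2 * A) ^ (2 * k) * (N * N)                   ≤⟨ *-monoʳ-≤ ((2 * A) ^ (2 * k)) (arrows⇒N²≤size G arrows) ⟩
    (2 * A) ^ (2 * k) * size G                    ∎
    where
    a^2k≡ : a ^ (2 * k) ≡ a ^ k * a ^ k
    a^2k≡ = trans (cong (a ^_) (cong (k +_) (+-identityʳ k))) (^-distribˡ-+-* a k k)
    regroup : ∀ c b h → c * (b * b) * (h * h) ≡ c * (b * h * (b * h))
    regroup = solve-∀

-- σ bounds log n from above, and τ bounds (log n) ^ (2 / (k + 1)).
record LogBounds (k n : ℕ) : Set where
  field
    σ τ  : ℕ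
    log≤ : ∀ p d → 2 ^ p ≤ n ^ d → p ≤ σ * d
    σ²≤  : σ ^ 2 ≤ τ ^ suc k

-- Here ℓ is the integer part of log n in base 16. Large ℓ are handled by `arrows⇒large`; for the
-- others `n` is bounded, and a constant suffices because an arrowing graph has an edge.
sizeBound : ∀ k → 1 ≤ k → ∃ λ C → ∀ n → 2 ≤ n → Σ (LogBounds k n) λ L →
            ∀ G → Arrows G (path n) (suc k) → n ^ (2 * k) * LogBounds.τ L ≤ C * size G
sizeBound k 1≤k = large + small , bound
  where
  open ≤-Reasoning
  σ₀ large small : ℕ
  σ₀ = 4 * (k + 9)
  large = 64 * (2 * (8 * (16 * k))) ^ (2 * k)
  small = (16 ^ (k + 9)) ^ (2 * k) * (σ₀ * σ₀)
  bound : ∀ n → 2 ≤ n → Σ (LogBounds k n) λ L →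
          ∀ G → Arrows G (path n) (suc k) → n ^ (2 * k) * LogBounds.τ L ≤ (large + small) * size G
  bound n 2≤n with bracket 16 1 n n (≤-trans (s≤s z≤n) 2≤n)
    (<-≤-trans (n<2^n n) (≤-trans (^-monoˡ-≤ n (m≤m+n 2 14)) (≤-reflexive (sym (*-identityʳ _)))))
  ... | ℓ , _ , lo , hi = cases
    where
    16^ℓ≤n : 16 ^ ℓ ≤ n
    16^ℓ≤n = ≤-trans (≤-reflexive (sym (*-identityʳ _))) lo
    n<16^ : n < 16 ^ suc ℓ
    n<16^ = <-≤-trans hi (≤-reflexive (*-identityʳ _))
    log≤ : ∀ p d → 2 ^ p ≤ n ^ d → p ≤ 4 * suc ℓ * d
    log≤ p d 2^p≤ with p ≤? 4 * suc ℓ * d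
    ... | yes p≤ = p≤
    ... | no p≰  = ⊥-elim (<-irrefl refl (begin-strict
      2 ^ p                 ≤⟨ 2^p≤ ⟩
      n ^ d                 ≤⟨ ^-monoˡ-≤ d (<⇒≤ n<16^) ⟩
      (16 ^ suc ℓ) ^ d      ≡⟨ ^-*-assoc 16 (suc ℓ) d ⟩
      (2 ^ 4) ^ (suc ℓ * d) ≡⟨ ^-*-assoc 2 4 (suc ℓ * d) ⟩
      2 ^ (4 * (suc ℓ * d)) ≡⟨ cong (2 ^_) (*-assoc 4 (suc ℓ) d) ⟨
      2 ^ (4 * suc ℓ * d)   <⟨ ^-monoʳ-< 2 (s≤s (s≤s z≤n)) (≰⇒> p≰) ⟩
      2 ^ p                 ∎))
    cases : Σ (LogBounds k n) λ L →
            ∀ G → Arrows G (path n) (suc k) → n ^ (2 * k) * LogBounds.τ L ≤ (large + small) * size G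
    -- With w = 16 the condition on ℓ is 512 k ≤ 2^ℓ, and 512 is 2^9 while k < 2^k.
    cases with k + 9 ≤? ℓ
    ... | yes k+9≤ℓ with ceilRoot k ℓ (≤-trans (≤-trans (s≤s z≤n) (m≤n+m 9 k)) k+9≤ℓ)
    ...   | h , 1≤h , h≤ℓ , ℓ≤h^ , h^≤ =
      -- The 4 is log 16. As 4 (ℓ + 1) ≤ 8 ℓ ≤ 8 h^(k+1), the square of `σ` is at most 64
      -- h^(2(k+1)), hence the 64 in `τ`.
      record { σ = 4 * suc ℓ ; τ = 64 * (h * h) ; log≤ = log≤ ; σ²≤ = σ²≤ } , edges
      where
      σ²≤ : (4 * suc ℓ) ^ 2 ≤ (64 * (h * h)) ^ suc k
      σ²≤ = begin
        (4 * suc ℓ) ^ 2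
          ≤⟨ ^-monoˡ-≤ 2 (*-monoʳ-≤ 4 (+-mono-≤ (≤-trans 1≤h h≤ℓ) (≤-reflexive (sym (+-identityʳ ℓ))))) ⟩
        (4 * (2 * ℓ)) ^ 2                           ≤⟨ ^-monoˡ-≤ 2 (*-monoʳ-≤ 4 (*-monoʳ-≤ 2 ℓ≤h^)) ⟩
        (4 * (2 * h ^ suc k)) ^ 2                   ≡⟨ ^2≡* (4 * (2 * h ^ suc k)) ⟩
        4 * (2 * h ^ suc k) * (4 * (2 * h ^ suc k)) ≡⟨ regroup (h ^ suc k) ⟩
        64 * (h ^ suc k * h ^ suc k)                ≤⟨ *-monoˡ-≤ _ (n≤n^suc 64 k) ⟩
        64 ^ suc k * (h ^ suc k * h ^ suc k)        ≡⟨ cong (64 ^ suc k *_) (^-distribʳ-* h h (suc k)) ⟨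
        64 ^ suc k * (h * h) ^ suc k                ≡⟨ ^-distribʳ-* 64 (h * h) (suc k) ⟨
        (64 * (h * h)) ^ suc k                      ∎
        where
        regroup : ∀ x → 4 * (2 * x) * (4 * (2 * x)) ≡ 64 * (x * x)
        regroup = solve-∀
      32wk≤ : 32 * (16 * k) ≤ 2 ^ ℓ
      32wk≤ = begin
        32 * (16 * k) ≡⟨ *-assoc 32 16 k ⟨
        512 * k       ≤⟨ *-monoʳ-≤ 512 (<⇒≤ (n<2^n k)) ⟩
        512 * 2 ^ k   ≡⟨ *-comm 512 (2 ^ k) ⟩
        2 ^ k * 2 ^ 9 ≡⟨ ^-distribˡ-+-* 2 k 9 ⟨
        2 ^ (k + 9)   ≤⟨ ^-monoʳ-≤ 2 k+9≤ℓ ⟩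
        2 ^ ℓ         ∎
      edges : ∀ G → Arrows G (path n) (suc k) → n ^ (2 * k) * (64 * (h * h)) ≤ (large + small) * size G
      edges G arrows = begin
        n ^ (2 * k) * (64 * (h * h)) ≡⟨ swap (n ^ (2 * k)) (h * h) ⟩
        64 * (n ^ (2 * k) * (h * h))
          ≤⟨ *-monoʳ-≤ 64 (arrows⇒large 16 k ℓ n h (m≤m+n 14 2) 1≤k 32wk≤ 16^ℓ≤n 1≤h h≤ℓ ℓ≤h^ h^≤ G arrows) ⟩
        64 * ((2 * (8 * (16 * k))) ^ (2 * k) * size G) ≡⟨ *-assoc 64 ((2 * (8 * (16 * k))) ^ (2 * k)) (size G) ⟨
        large * size G                                 ≤⟨ *-monoˡ-≤ (size G) (m≤m+n large small) ⟩
        (large + small) * size G                       ∎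
        where
        swap : ∀ a b → a * (64 * b) ≡ 64 * (a * b)
        swap = solve-∀
    cases | no k+9≰ℓ = record { σ = σ₀ ; τ = σ₀ * σ₀ ; log≤ = log≤′ ; σ²≤ = ≤-trans (≤-reflexive (^2≡* σ₀)) (n≤n^suc (σ₀ * σ₀) k) } , edges
      where
      1+ℓ≤ : suc ℓ ≤ k + 9
      1+ℓ≤ = ≰⇒> k+9≰ℓ
      log≤′ : ∀ p d → 2 ^ p ≤ n ^ d → p ≤ σ₀ * d
      log≤′ p d 2^p≤ = ≤-trans (log≤ p d 2^p≤) (*-monoˡ-≤ d (*-monoʳ-≤ 4 1+ℓ≤))
      edges : ∀ G → Arrows G (path n) (suc k) → n ^ (2 * k) * (σ₀ * σ₀) ≤ (large + small) * size G
      edges G arrows = begin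
        n ^ (2 * k) * (σ₀ * σ₀)
          ≤⟨ *-monoˡ-≤ (σ₀ * σ₀) (^-monoˡ-≤ (2 * k) (≤-trans (<⇒≤ n<16^) (^-monoʳ-≤ 16 1+ℓ≤))) ⟩
        small                    ≤⟨ m≤n+m small large ⟩
        large + small
          ≤⟨ m≤m*n (large + small) (size G) {{>-nonZero (arrows⇒1≤size {G} {n} {k} 2≤n arrows)}} ⟩
        (large + small) * size G ∎

-- Passage to rationals and to the real power of the logarithm

/-mono-≤ : ∀ m n d e → m * suc e ≤ n * suc d → ℤ.+ m ℚ./ suc d ℚ.≤ ℤ.+ n ℚ./ suc e
/-mono-≤ m n d e m≤n = ℚ.toℚᵘ-cancel-≤ (begin
  ℚ.toℚᵘ (ℤ.+ m ℚ./ suc d) ≃⟨ ℚ.toℚᵘ-fromℚᵘ (mkℚᵘ (ℤ.+ m) d) ⟩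
  mkℚᵘ (ℤ.+ m) d           ≤⟨ *≤* (subst₂ ℤ._≤_ (ℤ.pos-* m (suc e)) (ℤ.pos-* n (suc d)) (ℤ.+≤+ m≤n)) ⟩
  mkℚᵘ (ℤ.+ n) e           ≃⟨ ℚ.toℚᵘ-fromℚᵘ (mkℚᵘ (ℤ.+ n) e) ⟨
  ℚ.toℚᵘ (ℤ.+ n ℚ./ suc e) ∎)
  where open ℚᵘ.≤-Reasoning

fromℕ-mono-≤ : ∀ {m n} → m ≤ n → fromℕ m ℚ.≤ fromℕ n
fromℕ-mono-≤ {m} {n} m≤n = /-mono-≤ m n 0 0 (*-monoˡ-≤ 1 m≤n)

fromℕ-* : ∀ m n → fromℕ (m * n) ≡ fromℕ m ℚ.* fromℕ n
fromℕ-* m n = ℚ.toℚᵘ-injective (begin-equality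
  ℚ.toℚᵘ (fromℕ (m * n))                 ≃⟨ ℚ.toℚᵘ-fromℚᵘ (mkℚᵘ (ℤ.+ (m * n)) 0) ⟩
  mkℚᵘ (ℤ.+ (m * n)) 0                   ≃⟨ *≡* (cong (ℤ._* ℤ.+ 1) (ℤ.pos-* m n)) ⟩
  mkℚᵘ (ℤ.+ m) 0 ℚᵘ.* mkℚᵘ (ℤ.+ n) 0
    ≃⟨ ℚᵘ.*-cong (ℚ.toℚᵘ-fromℚᵘ (mkℚᵘ (ℤ.+ m) 0)) (ℚ.toℚᵘ-fromℚᵘ (mkℚᵘ (ℤ.+ n) 0)) ⟨
  ℚ.toℚᵘ (fromℕ m) ℚᵘ.* ℚ.toℚᵘ (fromℕ n) ≃⟨ ℚ.toℚᵘ-homo-* (fromℕ m) (fromℕ n) ⟨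
  ℚ.toℚᵘ (fromℕ m ℚ.* fromℕ n)           ∎)
  where open ℚᵘ.≤-Reasoning

fromℕ-^ : ∀ m n → fromℕ (m ^ n) ≡ fromℕ m ^ℚ n
fromℕ-^ m zero    = refl
fromℕ-^ m (suc n) = trans (fromℕ-* m (m ^ n)) (cong (fromℕ m ℚ.*_) (fromℕ-^ m n))

0≤fromℕ : ∀ n → 0ℚ ℚ.≤ fromℕ n
0≤fromℕ n = fromℕ-mono-≤ {0} {n} z≤n

fromℕ-suc-pos : ∀ n → ℚ.Positive (fromℕ (suc n))
fromℕ-suc-pos n = ℚ.normalize-pos (suc n) 1

^ℚ-nonNeg : ∀ {x} n → 0ℚ ℚ.≤ x → 0ℚ ℚ.≤ x ^ℚ n
^ℚ-nonNeg     zero    0≤x = 0≤fromℕ 1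
^ℚ-nonNeg {x} (suc n) 0≤x = ℚ.nonNegative⁻¹ _ {{ℚ.nonNeg*nonNeg⇒nonNeg x {{ℚ.nonNegative 0≤x}} _ {{ℚ.nonNegative (^ℚ-nonNeg n 0≤x)}}}}

^ℚ-mono-≤ : ∀ {x y} n → 0ℚ ℚ.≤ x → x ℚ.≤ y → x ^ℚ n ℚ.≤ y ^ℚ n
^ℚ-mono-≤         zero    0≤x x≤y = ℚ.≤-refl
^ℚ-mono-≤ {x} {y} (suc n) 0≤x x≤y = ℚ.≤-trans
  (ℚ.*-monoˡ-≤-nonNeg x {{ℚ.nonNegative 0≤x}} (^ℚ-mono-≤ n 0≤x x≤y))
  (ℚ.*-monoʳ-≤-nonNeg (y ^ℚ n) {{ℚ.nonNegative (^ℚ-nonNeg n (ℚ.≤-trans 0≤x x≤y))}} x≤y)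

^ℚ-mono-< : ∀ {x y} n → 0ℚ ℚ.≤ x → x ℚ.< y → x ^ℚ suc n ℚ.< y ^ℚ suc n
^ℚ-mono-< {x} {y} n 0≤x x<y = ℚ.≤-<-trans
  (ℚ.*-monoˡ-≤-nonNeg x {{ℚ.nonNegative 0≤x}} (^ℚ-mono-≤ n 0≤x (ℚ.<⇒≤ x<y)))
  (ℚ.*-monoˡ-<-pos (y ^ℚ n) {{^ℚ-pos n}} x<y)
  where
  y-pos : ℚ.Positive y
  y-pos = ℚ.positive (ℚ.≤-<-trans 0≤x x<y)
  ^ℚ-pos : ∀ n → ℚ.Positive (y ^ℚ n)
  ^ℚ-pos zero    = _
  ^ℚ-pos (suc n) = ℚ.pos*pos⇒pos y {{y-pos}} (y ^ℚ n) {{^ℚ-pos n}}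

-- If `t` exceeded `τ`, its power would exceed τ^(k+1) ≥ σ² ≥ (p/(d+1))², by strict monotonicity of
-- powers.
root≤ : ∀ {t} σ τ k p d → p ≤ σ * suc d → σ ^ 2 ≤ τ ^ suc k →
        t ^ℚ suc k ℚ.≤ (ℤ.+ p ℚ./ suc d) ^ℚ 2 → t ℚ.≤ fromℕ τ
root≤ {t} σ τ k p d p≤ σ²≤ t^≤ = ℚ.≮⇒≥ λ τ<t → ℚ.<-irrefl refl (begin-strict
  fromℕ τ ^ℚ suc k       <⟨ ^ℚ-mono-< k (0≤fromℕ τ) τ<t ⟩
  t ^ℚ suc k             ≤⟨ t^≤ ⟩
  (ℤ.+ p ℚ./ suc d) ^ℚ 2
    ≤⟨ ^ℚ-mono-≤ 2 (/-mono-≤ 0 p 0 d z≤n) (/-mono-≤ p σ d 0 (≤-trans (≤-reflexive (*-identityʳ p)) p≤)) ⟩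
  fromℕ σ ^ℚ 2           ≡⟨ fromℕ-^ σ 2 ⟨
  fromℕ (σ ^ 2)          ≤⟨ fromℕ-mono-≤ σ²≤ ⟩
  fromℕ (τ ^ suc k)      ≡⟨ fromℕ-^ τ (suc k) ⟩
  fromℕ τ ^ℚ suc k       ∎)
  where open ℚ.≤-Reasoning

recip : (c : ℚ) .{{_ : ℚ.Positive c}} → ℚ
recip c = (ℚ.1/ c) {{ℚ.pos⇒nonZero c}}

x≤c*y⇒recip-c*x≤y : ∀ c .{{_ : ℚ.Positive c}} {x y} → x ℚ.≤ c ℚ.* y → recip c ℚ.* x ℚ.≤ y
x≤c*y⇒recip-c*x≤y c {x} {y} x≤ = begin
  recip c ℚ.* x         ≤⟨ ℚ.*-monoˡ-≤-nonNeg (recip c) {{ℚ.pos⇒nonNeg (recip c) {{ℚ.1/pos⇒pos c}}}} x≤ ⟩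
  recip c ℚ.* (c ℚ.* y) ≡⟨ ℚ.*-assoc (recip c) c y ⟨
  recip c ℚ.* c ℚ.* y   ≡⟨ cong (ℚ._* y) (ℚ.*-inverseˡ c {{ℚ.pos⇒nonZero c}}) ⟩
  ℚ.1ℚ ℚ.* y            ≡⟨ ℚ.*-identityˡ y ⟩
  y                     ∎
  where open ℚ.≤-Reasoning

mainTheorem2 : ∀ (k : ℕ) → 1 ≤ k →
    Σ ℚ λ c₁ → (0ℚ ℚ.< c₁) ×
    (∀ (n : ℕ) → 2 ≤ n →
    ∀ (r : ℕ) → IsOrientedSizeRamsey (path n) (suc k) r →
    (c₁ ℚ.* fromℕ (n ^ (2 * k))) · (log₂ n ^[ 2 / suc k ]) ≤ᵣ fromℕ r)
mainTheorem2 k 1≤k with sizeBound k 1≤k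
... | C , bound = recip c , ℚ.positive⁻¹ (recip c) {{ℚ.1/pos⇒pos c}} , below
  where
  open ℚ.≤-Reasoning
  c : ℚ
  -- The successor makes the reciprocal available and positive whatever `C` is.
  c = fromℕ (suc C)
  instance
    c-pos : ℚ.Positive c
    c-pos = fromℕ-suc-pos C
  below : ∀ n → 2 ≤ n → ∀ r → IsOrientedSizeRamsey (path n) (suc k) r →
          (recip c ℚ.* fromℕ (n ^ (2 * k))) · (log₂ n ^[ 2 / suc k ]) ≤ᵣ fromℕ r
  -- `G` attains the minimum, so `r` is `size G`; the matched `t` is an arbitrary rational of the
  -- set that represents the power of log n.
  below n 2≤n r ((G , refl , arrows) , _) _ (t , (0≤t , _ , (p , d , refl , 2^p≤) , t^≤) , refl) with bound n 2≤n
  ... | L , edges = begin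
    recip c ℚ.* fromℕ K ℚ.* t   ≡⟨ ℚ.*-assoc (recip c) (fromℕ K) t ⟩
    recip c ℚ.* (fromℕ K ℚ.* t) ≤⟨ x≤c*y⇒recip-c*x≤y c (begin
      fromℕ K ℚ.* t
        ≤⟨ ℚ.*-monoˡ-≤-nonNeg (fromℕ K) {{ℚ.nonNegative (0≤fromℕ K)}} (root≤ σ τ k p d (log≤ p (suc d) 2^p≤) σ²≤ t^≤) ⟩
      fromℕ K ℚ.* fromℕ τ    ≡⟨ fromℕ-* K τ ⟨
      fromℕ (K * τ)          ≤⟨ fromℕ-mono-≤ (≤-trans (edges G arrows) (*-monoˡ-≤ (size G) (n≤1+n C))) ⟩
      fromℕ (suc C * size G) ≡⟨ fromℕ-* (suc C) (size G) ⟩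
      c ℚ.* fromℕ (size G)   ∎) ⟩
    fromℕ (size G) ∎
    where
    open LogBounds L
    K : ℕ
    K = n ^ (2 * k)
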